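{- There is an absolute constant $C$ such that for every $n\ge1$, every quadratic circuit over $GF(2)$ that computes the product of two $n\times n$ matrices has at least $3n^2 - Cn^{5/3}$ product gates.
   Context: The inputs are two $n\times n$ matrices of variables $x=(x_{i,j})$, $y=(y_{i,j})$, and the $n^2$ outputs are $(x\cdot y)_{i,j}=\sum_{k=1}^n x_{i,k}y_{k,j}$. An arithmetic circuit over a field $F$ is a directed acyclic graph whose in-degree-0 nodes are labeled by input variables, whose edges are labeled by field constants, and whose other nodes are sum gates or product gates; a node computes the sum (resp. product) of the values of its in-neighbours, each multiplied by the constant on the connecting edge. A quadratic circuit is an arithmetic circuit in which every product gate multiplies exactly two linear forms in the input variables (each may involve variables of both $x$ and $y$). -}

module Defs where

open import Data.Nat using (ℕ; zero; suc; _+_; _*_)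
open import Data.Bool using (Bool; true; false; _xor_; _∧_; if_then_else_)
open import Data.Fin using (Fin; zero; suc; combine; _↑ˡ_; _↑ʳ_)
open import Data.Fin.Properties using (_≟_; _<?_)
open import Data.Product using (Σ; _×_; _,_)
open import Relation.Nullary using (does)
open import Relation.Binary.PropositionalEquality using (_≡_)

-- GF(2) is modelled by Bool with _xor_ (addition) and _∧_ (multiplication).

Σ₂ : (k : ℕ) → (Fin k → Bool) → Bool
Σ₂ zero    f = false
Σ₂ (suc k) f = f zero xor Σ₂ k (λ i → f (suc i))

-- Homogeneous polynomials of degree ≤ 2 over GF(2) in N variables
-- (no constants ever appear in a circuit, so no constant term).
-- Canonical representation: quad a b is the coefficient of x_a x_b
-- for a ≤ b (including squares x_a^2 when a = b), and false for a > b.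
-- All operations below preserve this canonical form, so formal
-- polynomial equality is pointwise equality of coefficients.
record Poly (N : ℕ) : Set where
  constructor poly
  field
    lin  : Fin N → Bool
    quad : Fin N → Fin N → Bool
open Poly public

var : ∀ {N} → Fin N → Poly N
var v = poly (λ a → does (a ≟ v)) (λ _ _ → false)

scale : ∀ {N} → Bool → Poly N → Poly N
scale c p = poly (λ a → c ∧ lin p a) (λ a b → c ∧ quad p a b)

linComb : ∀ {N k} → (Fin k → Bool) → (Fin k → Poly N) → Poly N
linComb {k = k} c ps =
  poly (λ a → Σ₂ k (λ j → c j ∧ lin (ps j) a))
       (λ a b → Σ₂ k (λ j → c j ∧ quad (ps j) a b))

mulLin : ∀ {N} → (Fin N → Bool) → (Fin N → Bool) → Poly N
mulLin l m = poly (λ _ → false) q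
  where
  q : _ → _ → Bool
  q a b = if does (a <? b) then ((l a ∧ m b) xor (l b ∧ m a))
          else (if does (a ≟ b) then (l a ∧ m a) else false)

IsLinear : ∀ {N} → Poly N → Set
IsLinear p = ∀ a b → quad p a b ≡ false

-- Gates of an arithmetic circuit over GF(2) on N input variables, whose
-- in-neighbours are among the k previously listed gates.
--   input v       : in-degree-0 node labelled by variable v
--   sum c         : sum gate; c j is the GF(2) edge constant from gate j
--                   (c j = false means no edge)
--   prod c₁ j₁ c₂ j₂ : product gate with two in-edges (from j₁, j₂,
--                   constants c₁, c₂)
data Gate (N k : ℕ) : Set where
  input : Fin N → Gate N k
  sum   : (Fin k → Bool) → Gate N k
  prod  : Bool → Fin k → Bool → Fin k → Gate N k

-- A circuit is a topologically ordered list of gates (a DAG).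
data Circuit (N : ℕ) : ℕ → Set where
  []  : Circuit N 0
  _▷_ : ∀ {k} → Circuit N k → Gate N k → Circuit N (suc k)

gateValue : ∀ {N k} → (Fin k → Poly N) → Gate N k → Poly N
gateValue vals (input v)         = var v
gateValue vals (sum c)           = linComb c vals
gateValue vals (prod c₁ j₁ c₂ j₂) =
  mulLin (lin (scale c₁ (vals j₁))) (lin (scale c₂ (vals j₂)))

eval : ∀ {N k} → Circuit N k → Fin k → Poly N
eval (C ▷ g) zero    = gateValue (eval C) g
eval (C ▷ g) (suc j) = eval C j
-- note: node indices are listed newest-first: zero is the last gate added.

GateQuadratic : ∀ {N k} → (Fin k → Poly N) → Gate N k → Set
GateQuadratic vals (input v) = Data.Unit.⊤
  where import Data.Unit
GateQuadratic vals (sum c) = Data.Unit.⊤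
  where import Data.Unit
GateQuadratic vals (prod c₁ j₁ c₂ j₂) = IsLinear (vals j₁) × IsLinear (vals j₂)

Quadratic : ∀ {N k} → Circuit N k → Set
Quadratic [] = Data.Unit.⊤
  where import Data.Unit
Quadratic (C ▷ g) = Quadratic C × GateQuadratic (eval C) g

numProducts : ∀ {N k} → Circuit N k → ℕ
numProducts [] = 0
numProducts (C ▷ input _)      = numProducts C
numProducts (C ▷ sum _)        = numProducts C
numProducts (C ▷ prod _ _ _ _) = suc (numProducts C)

NVars : ℕ → ℕ
NVars n = n * n + n * n

xv : ∀ {n} → Fin n → Fin n → Fin (NVars n)
xv {n} i j = combine i j ↑ˡ (n * n)

yv : ∀ {n} → Fin n → Fin n → Fin (NVars n)
yv {n} i j = (n * n) ↑ʳ combine i j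

-- The polynomial (x·y)_{i,j} = Σ_k x_{i,k} y_{k,j}, canonical form
-- (every x-variable precedes every y-variable).
matEntry : (n : ℕ) → Fin n → Fin n → Poly (NVars n)
matEntry n i j =
  poly (λ _ → false)
       (λ a b → Σ₂ n (λ k → does (a ≟ xv i k) ∧ does (b ≟ yv k j)))

SamePoly : ∀ {N} → Poly N → Poly N → Set
SamePoly p q = (∀ a → lin p a ≡ lin q a) × (∀ a b → quad p a b ≡ quad q a b)

ComputesMatMul : (n : ℕ) → ∀ {k} → Circuit (NVars n) k → Set
ComputesMatMul n {k} C =
  Σ (Fin n → Fin n → Fin k) λ out →
    ∀ i j → SamePoly (eval C (out i j)) (matEntry n i j)

{-# OPTIONS --safe #-}
module Submission where

-- The coefficients with which the μ product gates enter Σ A_ij (xy)_ij form a linear code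
-- A ↦ code A in GF(2)^μ. The polar form of Σ A_ij (xy)_ij has rank 2n·rank A and every product
-- gate contributes rank at most 2, so code A has weight at least n·rank A. In particular the code
-- is injective; choose n² coordinates on which it is bijective and let (basis u) be the dual basis
-- of the matrix space. For M matrices written in this basis, the product over i < j of a fixed
-- minor of size r = n − M of the difference of the i-th and j-th matrix is a polynomial of degree
-- at most M²r in the coordinates, and it does not vanish at the first M powers of the nilpotent
-- shift. A nonzero polynomial over GF(2) of degree d does not vanish at some 0/1 point of weight at
-- most d, so there are M matrices involving only M²r basis elements whose differences all have
-- rank at least r. Their codewords vanish on all but M²r of the n² chosen coordinates and have
-- pairwise distance at least rn; Plotkin's bound on the remaining μ − n² + M²r coordinates gives
-- μ ≥ 3n² − O(M²n + n²/M), and M ≈ n^{1/3} is optimal.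

open import Defs
import Data.Nat.Properties as ℕ
open import Algebra.Properties.Semiring.Sum ℕ.+-*-semiring using (∑-distrib-+; ∑-comm; *-distribˡ-sum; *-distribʳ-sum; sum-cong-≗; sum-remove) renaming (sum to ∑)
open import Data.Bool using (Bool; true; false; not; _∧_; _∨_; _xor_; if_then_else_)
open import Data.Bool.Properties using (∧-zeroʳ; ∧-identityʳ; ∧-comm; ∧-assoc; ∧-distribˡ-xor; ∧-distribʳ-xor; ∨-comm; ∨-assoc; xor-comm; xor-assoc; xor-identityʳ; xor-same)
open import Data.Bool.Solver using (module xor-∧-Solver)
open import Data.Empty using (⊥; ⊥-elim)
open import Data.Fin using (Fin; zero; suc; toℕ; fromℕ<; combine; quotient; remainder; splitAt; punchIn; punchOut; _↑ˡ_; _↑ʳ_)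
open import Data.Fin.Properties using (_≟_; _<?_; <-cmp; toℕ-fromℕ<; toℕ-↑ˡ; toℕ-injective; toℕ<n; punchIn-punchOut; punchInᵢ≢i; punchOut-injective; remQuot-combine; combine-remQuot; combine-injective; splitAt-↑ˡ; splitAt-↑ʳ; splitAt⁻¹-↑ˡ; splitAt⁻¹-↑ʳ; ↑ˡ-injective; ↑ʳ-injective)
open import Data.Nat using (ℕ; zero; suc; _+_; _*_; _∸_; _^_; _≤_; _<_; z≤n; s≤s; s≤s⁻¹; >-nonZero)
open import Data.Nat.Solver using (module +-*-Solver)
open import Data.Product using (Σ; ∃; _×_; _,_; proj₁; proj₂)
open import Data.Sum using (_⊎_; inj₁; inj₂)
open import Data.Unit using (⊤; tt)
open import Data.Vec using (Vec; []; _∷_; lookup; tabulate)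
open import Data.Vec.Functional using (_++_; removeAt) renaming (_∷_ to _◂_)
open import Data.Vec.Functional.Properties using (lookup-++ˡ; lookup-++ʳ)
open import Data.Vec.Properties using (lookup∘tabulate)
open import Function using (_∘_; case_of_)
open import Relation.Binary using (tri<; tri≈; tri>)
open import Relation.Binary.PropositionalEquality using (_≡_; _≢_; refl; sym; trans; cong; cong₂; subst; module ≡-Reasoning)
open import Relation.Nullary using (Dec; does; yes; no; contradiction)
open import Relation.Nullary.Decidable using (dec-true; dec-false)

private
  variable
    k l m n p q r : ℕ


-- Boolean facts

false≢true : ∀ {b} → b ≡ false → b ≢ true
false≢true refl ()

xor-false⇒≡ : ∀ x {y} → x xor y ≡ false → x ≡ y
xor-false⇒≡ false eq = sym eq
xor-false⇒≡ true {true} eq = refl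

∧-trueˡ : ∀ {x y} → x ∧ y ≡ true → x ≡ true
∧-trueˡ {true} _ = refl

∧-trueʳ : ∀ {x y} → x ∧ y ≡ true → y ≡ true
∧-trueʳ {true} eq = eq

-- Sums over GF(2)

Σ₂-cong : ∀ k {f g : Fin k → Bool} → (∀ i → f i ≡ g i) → Σ₂ k f ≡ Σ₂ k g
Σ₂-cong zero    eq = refl
Σ₂-cong (suc k) eq = cong₂ _xor_ (eq zero) (Σ₂-cong k (eq ∘ suc))

Σ₂-zero : ∀ k {f : Fin k → Bool} → (∀ i → f i ≡ false) → Σ₂ k f ≡ false
Σ₂-zero zero    eq = refl
Σ₂-zero (suc k) eq = cong₂ _xor_ (eq zero) (Σ₂-zero k (eq ∘ suc))

xor-interchange : ∀ a b c d → (a xor b) xor (c xor d) ≡ (a xor c) xor (b xor d)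
xor-interchange = solve 4 (λ a b c d → (a :+ b) :+ (c :+ d) := (a :+ c) :+ (b :+ d)) refl
  where open xor-∧-Solver

Σ₂-xor : ∀ k (f g : Fin k → Bool) → Σ₂ k (λ i → f i xor g i) ≡ Σ₂ k f xor Σ₂ k g
Σ₂-xor zero    f g = refl
Σ₂-xor (suc k) f g = trans (cong ((f zero xor g zero) xor_) (Σ₂-xor k (f ∘ suc) (g ∘ suc)))
                           (xor-interchange (f zero) (g zero) _ _)

Σ₂-∧ˡ : ∀ k b (f : Fin k → Bool) → Σ₂ k (λ i → b ∧ f i) ≡ b ∧ Σ₂ k f
Σ₂-∧ˡ k true  f = refl
Σ₂-∧ˡ k false f = Σ₂-zero k λ _ → refl

Σ₂-∧ʳ : ∀ k b (f : Fin k → Bool) → Σ₂ k (λ i → f i ∧ b) ≡ Σ₂ k f ∧ b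
Σ₂-∧ʳ k b f = trans (Σ₂-cong k λ i → ∧-comm (f i) b) (trans (Σ₂-∧ˡ k b f) (∧-comm b _))

Σ₂-comm : ∀ k l (f : Fin k → Fin l → Bool) →
          Σ₂ k (λ i → Σ₂ l (f i)) ≡ Σ₂ l (λ j → Σ₂ k (λ i → f i j))
Σ₂-comm zero    l f = sym (Σ₂-zero l λ _ → refl)
Σ₂-comm (suc k) l f = trans (cong (Σ₂ l (f zero) xor_) (Σ₂-comm k l (f ∘ suc)))
                            (sym (Σ₂-xor l (f zero) _))

Σ₂-single : ∀ k (i₀ : Fin k) {f : Fin k → Bool} → (∀ i → i ≢ i₀ → f i ≡ false) → Σ₂ k f ≡ f i₀
Σ₂-single (suc k) zero     {f} eq =
  trans (cong (f zero xor_) (Σ₂-zero k λ i → eq (suc i) λ ())) (xor-identityʳ _)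
Σ₂-single (suc k) (suc i₀) {f} eq =
  cong₂ _xor_ (eq zero λ ()) (Σ₂-single k i₀ λ i i≢ → eq (suc i) λ { refl → i≢ refl })

Σ₂-δ : ∀ k (i₀ : Fin k) (f : Fin k → Bool) → Σ₂ k (λ i → f i ∧ does (i ≟ i₀)) ≡ f i₀
Σ₂-δ k i₀ f =
  trans (Σ₂-single k i₀ λ i i≢ → trans (cong (f i ∧_) (dec-false (i ≟ i₀) i≢)) (∧-zeroʳ (f i)))
        (trans (cong (f i₀ ∧_) (dec-true (i₀ ≟ i₀) refl)) (∧-identityʳ (f i₀)))

search : ∀ {k} (f : Fin k → Bool) → (∃ λ i → f i ≡ true) ⊎ (∀ i → f i ≡ false)
search {zero}  f = inj₂ λ ()
search {suc k} f with f zero in eq | search (f ∘ suc)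
... | true  | _            = inj₁ (zero , eq)
... | false | inj₁ (i , e) = inj₁ (suc i , e)
... | false | inj₂ none    = inj₂ λ { zero → eq ; (suc i) → none i }

Σ₂-true : ∀ k {f : Fin k → Bool} → Σ₂ k f ≡ true → ∃ λ i → f i ≡ true
Σ₂-true k {f} eq with search f
... | inj₁ found = found
... | inj₂ none  = contradiction eq (false≢true (Σ₂-zero k none))

-- In characteristic 2 the terms at (i, j) and (j, i) cancel, and the diagonal contributes nothing.
Σ₂-symmetric : ∀ k (g : Fin k → Fin k → Bool) → (∀ i j → g i j ≡ g j i) → (∀ i → g i i ≡ false) →
               Σ₂ k (λ i → Σ₂ k (g i)) ≡ false
Σ₂-symmetric zero    g sy di = refl
Σ₂-symmetric (suc k) g sy di = begin
  (g zero zero xor a) xor Σ₂ k (λ i → g (suc i) zero xor Σ₂ k (g (suc i) ∘ suc))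
    ≡⟨ cong₂ (λ x y → (x xor a) xor y) (di zero) (Σ₂-xor k (λ i → g (suc i) zero) _) ⟩
  a xor (Σ₂ k (λ i → g (suc i) zero) xor Σ₂ k (λ i → Σ₂ k (g (suc i) ∘ suc)))
    ≡⟨ cong₂ (λ x y → a xor (x xor y)) (Σ₂-cong k λ i → sy (suc i) zero)
             (Σ₂-symmetric k (λ i → g (suc i) ∘ suc) (λ i j → sy (suc i) (suc j)) (di ∘ suc)) ⟩
  a xor (a xor false)
    ≡⟨ cong (a xor_) (xor-identityʳ a) ⟩
  a xor a
    ≡⟨ xor-same a ⟩
  false ∎
  where
  open ≡-Reasoning
  a = Σ₂ k (g zero ∘ suc)

Σ₂-+ : ∀ k l (f : Fin (k + l) → Bool) → Σ₂ (k + l) f ≡ Σ₂ k (f ∘ (_↑ˡ l)) xor Σ₂ l (f ∘ (k ↑ʳ_))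
Σ₂-+ zero    l f = refl
Σ₂-+ (suc k) l f = trans (cong (f zero xor_) (Σ₂-+ k l (f ∘ suc))) (sym (xor-assoc (f zero) _ _))

Σ₂-* : ∀ k l (f : Fin (k * l) → Bool) → Σ₂ (k * l) f ≡ Σ₂ k (λ i → Σ₂ l (λ j → f (combine i j)))
Σ₂-* zero    l f = refl
Σ₂-* (suc k) l f = trans (Σ₂-+ l (k * l) f) (cong (Σ₂ l (λ j → f (j ↑ˡ (k * l))) xor_) (Σ₂-* k l (f ∘ (l ↑ʳ_))))

infix 7 _·_
_·_ : (Fin k → Bool) → (Fin k → Bool) → Bool
_·_ {k} u v = Σ₂ k (λ i → u i ∧ v i)

∧-swap : ∀ x y z → x ∧ (y ∧ z) ≡ y ∧ (x ∧ z)
∧-swap = solve 3 (λ x y z → x :* (y :* z) := y :* (x :* z)) refl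
  where open xor-∧-Solver

·-cong : {u v w z : Fin k → Bool} → (∀ i → u i ≡ w i) → (∀ i → v i ≡ z i) → u · v ≡ w · z
·-cong {k} e₁ e₂ = Σ₂-cong k λ i → cong₂ _∧_ (e₁ i) (e₂ i)

·-comm : (u v : Fin k → Bool) → u · v ≡ v · u
·-comm {k} u v = Σ₂-cong k λ i → ∧-comm (u i) (v i)

·-zeroʳ : (u : Fin k → Bool) {v : Fin k → Bool} → (∀ i → v i ≡ false) → u · v ≡ false
·-zeroʳ {k} u eq = Σ₂-zero k λ i → trans (cong (u i ∧_) (eq i)) (∧-zeroʳ (u i))

·-zeroˡ : {u : Fin k → Bool} (v : Fin k → Bool) → (∀ i → u i ≡ false) → u · v ≡ false
·-zeroˡ {k} v eq = Σ₂-zero k λ i → cong (_∧ v i) (eq i)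

·-xorˡ : (u v w : Fin k → Bool) → (λ i → u i xor v i) · w ≡ u · w xor v · w
·-xorˡ {k} u v w = trans (Σ₂-cong k λ i → ∧-distribʳ-xor (w i) (u i) (v i))
                         (Σ₂-xor k (λ i → u i ∧ w i) (λ i → v i ∧ w i))

·-xorʳ : (w u v : Fin k → Bool) → w · (λ i → u i xor v i) ≡ w · u xor w · v
·-xorʳ {k} w u v = trans (Σ₂-cong k λ i → ∧-distribˡ-xor (w i) (u i) (v i))
                         (Σ₂-xor k (λ i → w i ∧ u i) (λ i → w i ∧ v i))

·-exchange : (u : Fin k → Bool) (v : Fin l → Bool) (g : Fin k → Fin l → Bool) →
             u · (λ i → v · g i) ≡ v · (λ j → u · (λ i → g i j))
·-exchange {k} {l} u v g = begin
  Σ₂ k (λ i → u i ∧ Σ₂ l (λ j → v j ∧ g i j))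
    ≡⟨ Σ₂-cong k (λ i → sym (Σ₂-∧ˡ l (u i) _)) ⟩
  Σ₂ k (λ i → Σ₂ l (λ j → u i ∧ (v j ∧ g i j)))
    ≡⟨ Σ₂-comm k l _ ⟩
  Σ₂ l (λ j → Σ₂ k (λ i → u i ∧ (v j ∧ g i j)))
    ≡⟨ Σ₂-cong l (λ j → trans (Σ₂-cong k λ i → ∧-swap (u i) (v j) (g i j)) (Σ₂-∧ˡ k (v j) _)) ⟩
  Σ₂ l (λ j → v j ∧ Σ₂ k (λ i → u i ∧ g i j)) ∎
  where open ≡-Reasoning

-- Linear algebra over GF(2)

Nonzero : (Fin k → Bool) → Set
Nonzero v = ∃ λ i → v i ≡ true

TrivialKernel : (Fin q → Fin p → Bool) → Set
TrivialKernel {p = p} F = (v : Fin p → Bool) → (∀ e → v · F e ≡ false) → ∀ i → v i ≡ false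

-- Gaussian elimination; the rows of `F` are the equations. A pivot row clears the first unknown
-- from the other rows and is then removed, so equations and unknowns both drop by one.
kernel-vector : q < p → (F : Fin q → Fin p → Bool) →
                ∃ λ (v : Fin p → Bool) → Nonzero v × (∀ e → v · F e ≡ false)
kernel-vector {q} {suc p} q<p F with search (λ e → F e zero)
kernel-vector {q} {suc p} q<p F | inj₂ none =
  (true ◂ λ _ → false) , (zero , refl) ,
  λ e → cong₂ _xor_ (none e) (Σ₂-zero p λ _ → refl)
kernel-vector {suc q} {suc p} (s≤s q<p) F | inj₁ (e₀ , pivot)
  with kernel-vector q<p (λ e i → F (punchIn e₀ e) (suc i) xor (F (punchIn e₀ e) zero ∧ F e₀ (suc i)))
... | v , (i , vi) , ker = (v₀ ◂ v) , (suc i , vi) , eqn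
  where
  -- Back-substitution: the value of the first unknown that the pivot equation forces.
  v₀ = v · (F e₀ ∘ suc)
  reduced : ∀ e → (v₀ ∧ F (punchIn e₀ e) zero) xor v · (F (punchIn e₀ e) ∘ suc) ≡ false
  reduced e = begin
    (v₀ ∧ a) xor v · f
      ≡⟨ xor-comm (v₀ ∧ a) _ ⟩
    v · f xor (v₀ ∧ a)
      ≡⟨ cong (v · f xor_) (trans (∧-comm v₀ a) (sym (Σ₂-∧ˡ p a _))) ⟩
    v · f xor Σ₂ p (λ i → a ∧ (v i ∧ F e₀ (suc i)))
      ≡⟨ cong (v · f xor_) (Σ₂-cong p λ i → ∧-swap a (v i) (F e₀ (suc i))) ⟩
    v · f xor v · (λ i → a ∧ F e₀ (suc i))
      ≡⟨ ·-xorʳ v f _ ⟨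
    v · (λ i → f i xor (a ∧ F e₀ (suc i)))
      ≡⟨ ker e ⟩
    false ∎
    where
    open ≡-Reasoning
    a = F (punchIn e₀ e) zero
    f = F (punchIn e₀ e) ∘ suc
  eqn : ∀ e → (v₀ ◂ v) · F e ≡ false
  eqn e with e₀ ≟ e
  ... | yes refl = trans (cong (λ b → (v₀ ∧ b) xor v₀) pivot)
                         (trans (cong (_xor v₀) (∧-identityʳ v₀)) (xor-same v₀))
  ... | no e₀≢e  = subst (λ e → (v₀ ∧ F e zero) xor v · (F e ∘ suc) ≡ false)
                         (punchIn-punchOut e₀≢e) (reduced (punchOut e₀≢e))

-- With the right-hand side as an additional column there are n equations in n + 1 unknowns, hence a
-- nonzero solution. Its first unknown is true, since otherwise the others would form a nonzero
-- kernel vector of `F`.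
solve-square : (F : Fin n → Fin n → Bool) → TrivialKernel F →
               (b : Fin n → Bool) → ∃ λ v → ∀ e → v · F e ≡ b e
solve-square F triv b with kernel-vector ℕ.≤-refl (λ e → b e ◂ F e)
... | v , nz , ker with v zero in v₀
... | true  = v ∘ suc , λ e → sym (xor-false⇒≡ (b e) (ker e))
... | false = ⊥-elim (absurd nz)
  where
  absurd : Nonzero v → ⊥
  absurd (zero  , eq) = false≢true v₀ eq
  absurd (suc i , eq) = false≢true (triv (v ∘ suc) ker i) eq

-- The value `u e₀` is the pairing of `u` with a unit vector. That unit vector is `v · F e` for a
-- suitable `v`, and exchanging the sums leaves only pairings that vanish by hypothesis.
transpose-trivial : (F : Fin n → Fin n → Bool) → TrivialKernel F → TrivialKernel (λ i e → F e i)
transpose-trivial {n} F triv u ker e₀ with solve-square F triv (λ e → does (e ≟ e₀))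
... | v , sol = begin
  u e₀                             ≡⟨ Σ₂-δ n e₀ u ⟨
  u · (λ e → does (e ≟ e₀))        ≡⟨ ·-cong {u = u} (λ _ → refl) (λ e → sym (sol e)) ⟩
  u · (λ e → v · F e)              ≡⟨ ·-exchange u v F ⟩
  v · (λ i → u · (λ e → F e i))    ≡⟨ ·-zeroʳ v ker ⟩
  false                            ∎
  where open ≡-Reasoning

module _ (Φ : Fin q → Fin n → Bool) (triv : TrivialKernel Φ) where

  -- While j < n, some nonzero `v` is orthogonal to the rows chosen so far, and by triviality of the
  -- kernel some row `e` is not orthogonal to `v`. Pairing a dependence among the enlarged rows with
  -- `v` leaves only the coefficient of row `e`.
  independent-rows : ∀ j → j ≤ n → ∃ λ (κ : Fin j → Fin q) → TrivialKernel (λ e s → Φ (κ s) e)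
  independent-rows zero    _   = (λ ()) , λ _ _ ()
  independent-rows (suc j) j<n with independent-rows j (ℕ.<⇒≤ j<n)
  ... | κ , indep with kernel-vector j<n (Φ ∘ κ)
  ... | v , (i , vi) , ker with search (λ e → v · Φ e)
  ... | inj₂ none     = contradiction vi (false≢true (triv v none i))
  ... | inj₁ (e , ve) = (e ◂ κ) , indep′
    where
    indep′ : TrivialKernel (λ c s → Φ ((e ◂ κ) s) c)
    indep′ u eqs = λ { zero → u₀ ; (suc s) → indep (u ∘ suc) rest s }
      where
      open ≡-Reasoning
      rest : ∀ c → (u ∘ suc) · (λ s → Φ (κ s) c) ≡ false
      u₀ : u zero ≡ false
      u₀ = begin
        u zero
          ≡⟨ trans (xor-identityʳ _) (∧-identityʳ (u zero)) ⟨
        (u zero ∧ true) xor false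
          ≡⟨ cong₂ (λ x y → (u zero ∧ x) xor y) ve (·-zeroʳ (u ∘ suc) ker) ⟨
        u · (λ s → v · Φ ((e ◂ κ) s))
          ≡⟨ ·-exchange u v (λ s → Φ ((e ◂ κ) s)) ⟩
        v · (λ c → u · (λ s → Φ ((e ◂ κ) s) c))
          ≡⟨ ·-zeroʳ v eqs ⟩
        false ∎
      rest c = trans (cong (λ b → (b ∧ Φ e c) xor (u ∘ suc) · (λ s → Φ (κ s) c)) (sym u₀)) (eqs c)

  -- The n independent rows form an invertible square matrix, so these n coordinates already
  -- determine a codeword.
  information-set : ∃ λ (κ : Fin n → Fin q) → TrivialKernel (Φ ∘ κ)
  information-set with independent-rows n ℕ.≤-refl
  ... | κ , indep = κ , transpose-trivial (λ e s → Φ (κ s) e) indep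

-- Gates needed for a bilinear form

bit : Bool → ℕ
bit false = 0
bit true  = 1

count : (Fin k → Bool) → ℕ
count w = ∑ (λ i → bit (w i))

support : (w : Fin k → Bool) → ∃ λ (σ : Fin (count w) → Fin k) → ∀ e → w e ≡ true → ∃ λ i → σ i ≡ e
support {zero}  w = (λ ()) , λ ()
support {suc k} w with w zero in w₀ | support (w ∘ suc)
... | true  | σ , onto = (zero ◂ suc ∘ σ) ,
  λ { zero _ → zero , refl ; (suc e) we → let i , eq = onto e we in suc i , cong suc eq }
... | false | σ , onto = suc ∘ σ ,
  λ { zero we → contradiction we (false≢true w₀) ; (suc e) we → let i , eq = onto e we in i , cong suc eq }

polar : (f g : Fin n → Bool) → Fin n → Fin n → Bool
polar f g a b = (f a ∧ g b) xor (f b ∧ g a)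

-- The canonical form stores both cross terms at the ordered pair only. Adding the transpose gives
-- an alternating form that is a sum of two forms of rank at most one.
mulLin-polar : (f g : Fin n → Bool) (a b : Fin n) →
               quad (mulLin f g) a b xor quad (mulLin f g) b a ≡ polar f g a b
mulLin-polar f g a b with <-cmp a b
... | tri< a<b a≢b b≮a rewrite dec-true (a <? b) a<b | dec-false (b <? a) b≮a | dec-false (b ≟ a) (a≢b ∘ sym) =
  xor-identityʳ _
... | tri≈ a≮b refl _ rewrite dec-false (a <? a) a≮b | dec-true (a ≟ a) refl = refl
... | tri> a≮b a≢b b<a rewrite dec-true (b <? a) b<a | dec-false (a <? b) a≮b | dec-false (a ≟ b) a≢b =
  xor-comm (f b ∧ g a) (f a ∧ g b)

-- The quadratic part of Σ A_ij (xy)_ij.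
form : ∀ n → (Fin (n * n) → Bool) → Fin (NVars n) → Fin (NVars n) → Bool
form n A a b = A · (λ e → quad (matEntry n (quotient n e) (remainder {n} n e)) a b)

does-sym : (i j : Fin n) → does (i ≟ j) ≡ does (j ≟ i)
does-sym i j with i ≟ j
... | yes refl = sym (dec-true (i ≟ i) refl)
... | no i≢j   = sym (dec-false (j ≟ i) (i≢j ∘ sym))

↑ˡ≢↑ʳ : {i : Fin m} {j : Fin n} → i ↑ˡ n ≢ m ↑ʳ j
↑ˡ≢↑ʳ {m} {n} {i} {j} eq
  with () ← trans (sym (splitAt-↑ˡ m i n)) (trans (cong (splitAt m) eq) (splitAt-↑ʳ m n j))

module _ (n : ℕ) (A : Fin (n * n) → Bool) where

  private
    xv-injective : ∀ {i k i′ k′ : Fin n} → xv i k ≡ xv i′ k′ → i ≡ i′ × k ≡ k′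
    xv-injective eq = combine-injective _ _ _ _ (↑ˡ-injective (n * n) _ _ eq)

    yv-injective : ∀ {i k i′ k′ : Fin n} → yv i k ≡ yv i′ k′ → i ≡ i′ × k ≡ k′
    yv-injective eq = combine-injective _ _ _ _ (↑ʳ-injective (n * n) _ _ eq)

  -- This block is `A` tensored with the identity matrix of size n, so its rank is n times that of
  -- `A`.
  form-xy : ∀ i k k′ j → form n A (xv i k) (yv k′ j) ≡ A (combine i j) ∧ does (k ≟ k′)
  form-xy i k k′ j = begin
    form n A (xv i k) (yv k′ j)
      ≡⟨ Σ₂-cong (n * n) (λ e → cong (A e ∧_) (inner (quotient n e) (remainder {n} n e))) ⟩
    A · (λ e → term (quotient n e) (remainder {n} n e))
      ≡⟨ Σ₂-single (n * n) (combine i j) off ⟩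
    A (combine i j) ∧ term (quotient n (combine i j)) (remainder {n} n (combine i j))
      ≡⟨ cong (λ (i′ , j′) → A (combine i j) ∧ term i′ j′) (remQuot-combine i j) ⟩
    A (combine i j) ∧ term i j
      ≡⟨ cong (A (combine i j) ∧_) diag ⟩
    A (combine i j) ∧ does (k ≟ k′) ∎
    where
    open ≡-Reasoning
    term : Fin n → Fin n → Bool
    term i′ j′ = does (xv i k ≟ xv i′ k) ∧ does (yv k′ j ≟ yv k j′)

    inner : ∀ i′ j′ → quad (matEntry n i′ j′) (xv i k) (yv k′ j) ≡ term i′ j′
    inner i′ j′ = Σ₂-single n k λ k″ k″≢k →
      cong (_∧ _) (dec-false (xv i k ≟ xv i′ k″) λ eq → k″≢k (sym (proj₂ (xv-injective eq))))

    off : ∀ e → e ≢ combine i j → A e ∧ term (quotient n e) (remainder {n} n e) ≡ false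
    off e e≢ with xv i k ≟ xv (quotient n e) k | yv k′ j ≟ yv k (remainder {n} n e)
    ... | no _    | _       = ∧-zeroʳ (A e)
    ... | yes _   | no _    = ∧-zeroʳ (A e)
    ... | yes eq₁ | yes eq₂ = contradiction
      (trans (sym (combine-remQuot {n} n e))
             (sym (cong₂ combine (proj₁ (xv-injective eq₁)) (proj₂ (yv-injective eq₂))))) e≢

    diag : term i j ≡ does (k ≟ k′)
    diag rewrite dec-true (xv i k ≟ xv i k) refl with k ≟ k′
    ... | yes refl = dec-true (yv k j ≟ yv k j) refl
    ... | no k≢k′  = dec-false (yv k′ j ≟ yv k j) λ eq → k≢k′ (sym (proj₁ (yv-injective eq)))

  form-y : ∀ (k j : Fin n) b → form n A (yv k j) b ≡ false
  form-y k j b = ·-zeroʳ A λ e → Σ₂-zero n λ k′ →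
    cong (_∧ does (b ≟ yv k′ (remainder {n} n e)))
         (dec-false (yv k j ≟ xv (quotient n e) k′) (↑ˡ≢↑ʳ {n * n} {n * n} ∘ sym))

  form-x : ∀ a (i k : Fin n) → form n A a (xv i k) ≡ false
  form-x a i k = ·-zeroʳ A λ e → Σ₂-zero n λ k′ →
    trans (cong (does (a ≟ xv (quotient n e) k′) ∧_)
                (dec-false (xv i k ≟ yv k′ (remainder {n} n e)) (↑ˡ≢↑ʳ {n * n} {n * n})))
          (∧-zeroʳ (does (a ≟ xv (quotient n e) k′)))

  polarForm : Fin (NVars n) → Fin (NVars n) → Bool
  polarForm a b = form n A a b xor form n A b a

  polarForm-xy : ∀ i k k′ j → polarForm (xv i k) (yv k′ j) ≡ A (combine i j) ∧ does (k ≟ k′)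
  polarForm-xy i k k′ j = trans (cong₂ _xor_ (form-xy i k k′ j) (form-y k′ j (xv i k))) (xor-identityʳ _)

  polarForm-yx : ∀ k j i k′ → polarForm (yv k j) (xv i k′) ≡ A (combine i j) ∧ does (k ≟ k′)
  polarForm-yx k j i k′ = trans (xor-comm (form n A (yv k j) (xv i k′)) _)
    (trans (polarForm-xy i k′ k j) (cong (A (combine i j) ∧_) (does-sym k′ k)))

  polarForm-xx : ∀ (i k i′ k′ : Fin n) → polarForm (xv i k) (xv i′ k′) ≡ false
  polarForm-xx i k i′ k′ = cong₂ _xor_ (form-x (xv i k) i′ k′) (form-x (xv i′ k′) i k)

  polarForm-yy : ∀ (k j k′ j′ : Fin n) → polarForm (yv k j) (yv k′ j′) ≡ false
  polarForm-yy k j k′ j′ = cong₂ _xor_ (form-y k j (yv k′ j′)) (form-y k′ j′ (yv k j))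

-- Tensoring with the identity acts on each slice of `v` separately; only the slice with second
-- index `k` is seen.
·-collapse : ∀ n (v : Fin (r * n) → Bool) (g : Fin r → Bool) (k : Fin n) →
             v · (λ u → g (quotient n u) ∧ does (remainder {r} n u ≟ k)) ≡ (λ p → v (combine p k)) · g
·-collapse {r} n v g k = begin
  v · (λ u → g (quotient n u) ∧ does (remainder {r} n u ≟ k))
    ≡⟨ Σ₂-* r n _ ⟩
  Σ₂ r (λ p → Σ₂ n (λ c → v (combine p c) ∧ (g (quotient n (combine p c)) ∧ does (remainder {r} n (combine p c) ≟ k))))
    ≡⟨ Σ₂-cong r (λ p → Σ₂-cong n λ c →
         trans (cong (λ (p′ , c′) → v (combine p c) ∧ (g p′ ∧ does (c′ ≟ k))) (remQuot-combine p c))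
               (sym (∧-assoc (v (combine p c)) _ _))) ⟩
  Σ₂ r (λ p → Σ₂ n (λ c → (v (combine p c) ∧ g p) ∧ does (c ≟ k)))
    ≡⟨ Σ₂-cong r (λ p → Σ₂-δ n k (λ c → v (combine p c) ∧ g p)) ⟩
  (λ p → v (combine p k)) · g ∎
  where open ≡-Reasoning

-- The polar form of Σ A_ij (xy)_ij has rank at least 2rn, and a product gate contributes rank 2.
rank-bound : ∀ {μ} (f g : Fin μ → Fin (NVars n) → Bool) (w : Fin μ → Bool) (A : Fin (n * n) → Bool) →
             (∀ a b → w · (λ t → quad (mulLin (f t) (g t)) a b) ≡ form n A a b) →
             (ρ γ : Fin r → Fin n) → TrivialKernel (λ q p → A (combine (ρ p) (γ q))) →
             r * n ≤ count w
rank-bound {n} {r} {μ} f g w A computes ρ γ triv with r * n ℕ.≤? count w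
... | yes le = le
... | no ¬le = ⊥-elim (nonzero⇒⊥ (proj₁ (proj₂ solution)))
  where
  open ≡-Reasoning
  σ = proj₁ (support w)
  -- The variables in the rows `ρ` of x and in the columns `γ` of y, `r * n` of each kind.
  xs ys : Fin (r * n) → Fin (NVars n)
  xs u = xv (ρ (quotient n u)) (remainder {r} n u)
  ys u = yv (remainder {r} n u) (γ (quotient n u))
  P : Fin (r * n + r * n) → Fin (NVars n)
  P = xs ++ ys
  F : Fin (count w) → Fin (r * n + r * n) → Bool
  F e i = f (σ e) (P i)
  G : Fin (count w) → Fin (r * n + r * n) → Bool
  G e i = g (σ e) (P i)

  -- Each gate in the support of `w` imposes two conditions, one per factor. If `count w < r * n`
  -- these are fewer than the 2rn chosen variables, so some nonzero `v` satisfies all of them.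
  solution = kernel-vector (ℕ.+-mono-< (ℕ.≰⇒> ¬le) (ℕ.≰⇒> ¬le)) (F ++ G)
  v = proj₁ solution

  f-vanishes : ∀ t → w t ≡ true → v · (f t ∘ P) ≡ false
  f-vanishes t wt with proj₂ (support w) t wt
  ... | e , refl = trans (cong (v ·_) (sym (lookup-++ˡ F G e))) (proj₂ (proj₂ solution) (e ↑ˡ count w))

  g-vanishes : ∀ t → w t ≡ true → v · (g t ∘ P) ≡ false
  g-vanishes t wt with proj₂ (support w) t wt
  ... | e , refl = trans (cong (v ·_) (sym (lookup-++ʳ F G e))) (proj₂ (proj₂ solution) (count w ↑ʳ e))

  computes-polar : ∀ a b → w · (λ t → polar (f t) (g t) a b) ≡ polarForm n A a b
  computes-polar a b = begin
    w · (λ t → polar (f t) (g t) a b)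
      ≡⟨ ·-cong {u = w} (λ _ → refl) (λ t → sym (mulLin-polar (f t) (g t) a b)) ⟩
    w · (λ t → quad (mulLin (f t) (g t)) a b xor quad (mulLin (f t) (g t)) b a)
      ≡⟨ ·-xorʳ w (λ t → quad (mulLin (f t) (g t)) a b) _ ⟩
    w · (λ t → quad (mulLin (f t) (g t)) a b) xor w · (λ t → quad (mulLin (f t) (g t)) b a)
      ≡⟨ cong₂ _xor_ (computes a b) (computes b a) ⟩
    polarForm n A a b ∎

  polar-vanishes : ∀ b t → w t ∧ v · (λ i → polar (f t) (g t) (P i) b) ≡ false
  polar-vanishes b t with w t in wt
  ... | false = refl
  ... | true  = begin
    v · (λ i → (f t (P i) ∧ g t b) xor (f t b ∧ g t (P i)))
      ≡⟨ ·-xorʳ v (λ i → f t (P i) ∧ g t b) _ ⟩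
    v · (λ i → f t (P i) ∧ g t b) xor v · (λ i → f t b ∧ g t (P i))
      ≡⟨ cong₂ _xor_
           (trans (Σ₂-cong d λ i → sym (∧-assoc (v i) (f t (P i)) (g t b))) (Σ₂-∧ʳ d (g t b) _))
           (trans (Σ₂-cong d λ i → ∧-swap (v i) (f t b) (g t (P i))) (Σ₂-∧ˡ d (f t b) _)) ⟩
    (v · (f t ∘ P) ∧ g t b) xor (f t b ∧ v · (g t ∘ P))
      ≡⟨ cong₂ (λ x y → (x ∧ g t b) xor (f t b ∧ y)) (f-vanishes t wt) (g-vanishes t wt) ⟩
    f t b ∧ false
      ≡⟨ ∧-zeroʳ (f t b) ⟩
    false ∎
    where d = r * n + r * n

  -- Every gate with nonzero coefficient vanishes when one argument of its polar form is `v`, so `v`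
  -- is orthogonal to every variable.
  radical : ∀ b → v · (λ i → polarForm n A (P i) b) ≡ false
  radical b = begin
    v · (λ i → polarForm n A (P i) b)
      ≡⟨ ·-cong {u = v} (λ _ → refl) (λ i → sym (computes-polar (P i) b)) ⟩
    v · (λ i → w · (λ t → polar (f t) (g t) (P i) b))
      ≡⟨ ·-exchange v w (λ i t → polar (f t) (g t) (P i) b) ⟩
    w · (λ t → v · (λ i → polar (f t) (g t) (P i) b))
      ≡⟨ Σ₂-zero μ (polar-vanishes b) ⟩
    false ∎

  vx vy : Fin (r * n) → Bool
  vx u = v (u ↑ˡ (r * n))
  vy u = v ((r * n) ↑ʳ u)

  radical-split : ∀ b → vx · (λ u → polarForm n A (xs u) b) xor vy · (λ u → polarForm n A (ys u) b) ≡ false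
  radical-split b = trans (sym (trans (Σ₂-+ (r * n) (r * n) _) (cong₂ _xor_
    (Σ₂-cong (r * n) λ u → cong (λ a → vx u ∧ polarForm n A a b) (lookup-++ˡ xs ys u))
    (Σ₂-cong (r * n) λ u → cong (λ a → vy u ∧ polarForm n A a b) (lookup-++ʳ xs ys u))))) (radical b)

  -- Testing against the y-variables in column `γ q` removes the y-half of `v`, because the y-y
  -- block is zero. What remains is slice `c` of the x-half paired with column q of the chosen
  -- submatrix of `A`.
  vx-zero : ∀ c p → vx (combine p c) ≡ false
  vx-zero c = triv (λ p → vx (combine p c)) λ q → begin
    (λ p → vx (combine p c)) · (λ p → A (combine (ρ p) (γ q)))
      ≡⟨ ·-collapse n vx (λ p → A (combine (ρ p) (γ q))) c ⟨
    vx · (λ u → A (combine (ρ (quotient n u)) (γ q)) ∧ does (remainder {r} n u ≟ c))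
      ≡⟨ ·-cong {u = vx} (λ _ → refl) (λ u → sym (polarForm-xy n A _ _ c (γ q))) ⟩
    vx · (λ u → polarForm n A (xs u) (yv c (γ q)))
      ≡⟨ xor-false⇒≡ _ (radical-split (yv c (γ q))) ⟩
    vy · (λ u → polarForm n A (ys u) (yv c (γ q)))
      ≡⟨ ·-zeroʳ vy (λ u → polarForm-yy n A (remainder {r} n u) (γ (quotient n u)) c (γ q)) ⟩
    false ∎

  -- Symmetrically, the x-variables in row `ρ p` isolate the y-half, which meets the transposed
  -- submatrix.
  vy-zero : ∀ c q → vy (combine q c) ≡ false
  vy-zero c = transpose-trivial (λ q p → A (combine (ρ p) (γ q))) triv (λ q → vy (combine q c)) λ p → begin
    (λ q → vy (combine q c)) · (λ q → A (combine (ρ p) (γ q)))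
      ≡⟨ ·-collapse n vy (λ q → A (combine (ρ p) (γ q))) c ⟨
    vy · (λ u → A (combine (ρ p) (γ (quotient n u))) ∧ does (remainder {r} n u ≟ c))
      ≡⟨ ·-cong {u = vy} (λ _ → refl) (λ u → sym (polarForm-yx n A _ _ (ρ p) c)) ⟩
    vy · (λ u → polarForm n A (ys u) (xv (ρ p) c))
      ≡⟨ xor-false⇒≡ _ (radical-split (xv (ρ p) c)) ⟨
    vx · (λ u → polarForm n A (xs u) (xv (ρ p) c))
      ≡⟨ ·-zeroʳ vx (λ u → polarForm-xx n A (ρ (quotient n u)) (remainder {r} n u) (ρ p) c) ⟩
    false ∎

  nonzero⇒⊥ : Nonzero v → ⊥
  nonzero⇒⊥ (i , vi) with splitAt (r * n) i in eq
  ... | inj₁ u = false≢true (trans (cong vx (sym (combine-remQuot {r} n u))) (vx-zero _ _))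
                            (trans (cong v (splitAt⁻¹-↑ˡ eq)) vi)
  ... | inj₂ u = false≢true (trans (cong vy (sym (combine-remQuot {r} n u))) (vy-zero _ _))
                            (trans (cong v (splitAt⁻¹-↑ʳ eq)) vi)

-- Quadratic parts of circuit nodes

record Decomposition {N k} (vals : Fin k → Poly N) (μ : ℕ) : Set where
  field
    left right : Fin μ → Fin N → Bool
    coef       : Fin k → Fin μ → Bool
    quad-coef  : ∀ j a b → quad (vals j) a b ≡ coef j · (λ t → quad (mulLin (left t) (right t)) a b)

-- An input has the zero coefficient vector, a sum gate combines the vectors of its in-neighbours,
-- and a product gate opens a fresh coordinate.
decompose : ∀ {N} (Γ : Circuit N k) → Decomposition (eval Γ) (numProducts Γ)
decompose [] = record { left = λ () ; right = λ () ; coef = λ () ; quad-coef = λ () }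
decompose (Γ ▷ input v) = record
  { left = left ; right = right ; coef = (λ _ → false) ◂ coef
  ; quad-coef = λ { zero a b → sym (Σ₂-zero (numProducts Γ) λ _ → refl) ; (suc j) → quad-coef j } }
  where open Decomposition (decompose Γ)
decompose {k = suc k} (Γ ▷ sum c) = record
  { left = left ; right = right ; coef = (λ t → c · (λ j → coef j t)) ◂ coef
  ; quad-coef = λ { zero a b → eqn a b ; (suc j) → quad-coef j } }
  where
  open Decomposition (decompose Γ)
  open ≡-Reasoning
  μ = numProducts Γ
  eqn : ∀ a b → c · (λ j → quad (eval Γ j) a b) ≡
                (λ t → c · (λ j → coef j t)) · (λ t → quad (mulLin (left t) (right t)) a b)
  eqn a b = begin
    c · (λ j → quad (eval Γ j) a b)
      ≡⟨ ·-cong {u = c} (λ _ → refl) (λ j → trans (quad-coef j a b) (·-comm (coef j) h)) ⟩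
    c · (λ j → h · coef j)
      ≡⟨ ·-exchange c h coef ⟩
    h · (λ t → c · (λ j → coef j t))
      ≡⟨ ·-comm h _ ⟩
    (λ t → c · (λ j → coef j t)) · h ∎
    where
    h : Fin μ → Bool
    h t = quad (mulLin (left t) (right t)) a b
decompose (Γ ▷ prod c₁ j₁ c₂ j₂) = record
  { left = l₁ ◂ left ; right = l₂ ◂ right
  ; coef = (true ◂ λ _ → false) ◂ (λ j → false ◂ coef j)
  ; quad-coef = λ { zero a b → sym (trans (cong (quad (mulLin l₁ l₂) a b xor_) (Σ₂-zero (numProducts Γ) λ _ → refl)) (xor-identityʳ _))
                  ; (suc j) → quad-coef j } }
  where
  open Decomposition (decompose Γ)
  l₁ = lin (scale c₁ (eval Γ j₁))
  l₂ = lin (scale c₂ (eval Γ j₂))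

-- Determinants

_∪[_] : (Fin r → Bool) → Fin r → Fin r → Bool
(U ∪[ i ]) i′ = does (i′ ≟ i) ∨ U i′

-- The signless Laplace expansion: the sum of all maximal minors of the columns c that
-- avoid the rows in U.
minors : (Fin r → Bool) → (Fin m → Fin r → Bool) → Bool
minors {m = zero}      U c = true
minors {r} {m = suc m} U c = Σ₂ r λ i → (not (U i) ∧ c zero i) ∧ minors (U ∪[ i ]) (c ∘ suc)

minors-cong : {U W : Fin r → Bool} {c d : Fin m → Fin r → Bool} →
              (∀ i → U i ≡ W i) → (∀ j i → c j i ≡ d j i) → minors U c ≡ minors W d
minors-cong     {m = zero}  eq eq′ = refl
minors-cong {r} {m = suc m} eq eq′ = Σ₂-cong r λ i →
  cong₂ _∧_ (cong₂ (λ u x → not u ∧ x) (eq i) (eq′ zero i))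
            (minors-cong (λ i′ → cong (does (i′ ≟ i) ∨_) (eq i′)) (eq′ ∘ suc))

module _ (U : Fin r → Bool) (c : Fin m → Fin r → Bool) (a b : Fin r → Bool) where

  private
    term : (a b : Fin r → Bool) → Fin r → Fin r → Bool
    term a b i i′ = (not (U i) ∧ a i) ∧ ((not ((U ∪[ i ]) i′) ∧ b i′) ∧ minors (U ∪[ i ] ∪[ i′ ]) c)

    term-swap : ∀ a b i i′ → term a b i i′ ≡ term b a i′ i
    term-swap a b i i′
      rewrite minors-cong {U = U ∪[ i ] ∪[ i′ ]} {W = U ∪[ i′ ] ∪[ i ]} {c = c}
                (λ x → trans (sym (∨-assoc (does (x ≟ i′)) (does (x ≟ i)) (U x)))
                       (trans (cong (_∨ U x) (∨-comm (does (x ≟ i′)) (does (x ≟ i))))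
                              (∨-assoc (does (x ≟ i)) (does (x ≟ i′)) (U x)))) (λ _ _ → refl)
            | does-sym i′ i = boolean (U i) (U i′) (does (i ≟ i′)) (a i) (b i′) (minors (U ∪[ i′ ] ∪[ i ]) c)
      where
      boolean : ∀ u u′ e x y d → (not u ∧ x) ∧ ((not (e ∨ u′) ∧ y) ∧ d) ≡ (not u′ ∧ y) ∧ ((not (e ∨ u) ∧ x) ∧ d)
      boolean true  true  e     x     y     d = refl
      boolean true  false true  x     y     d = sym (∧-zeroʳ y)
      boolean true  false false x     y     d = sym (∧-zeroʳ y)
      boolean false true  true  x     y     d = ∧-zeroʳ x
      boolean false true  false x     y     d = ∧-zeroʳ x
      boolean false false true  x     y     d = trans (∧-zeroʳ x) (sym (∧-zeroʳ y))
      boolean false false false x     y     d = ∧-swap x y d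

    term-diagonal : ∀ i → term a a i i ≡ false
    term-diagonal i rewrite dec-true (i ≟ i) refl = ∧-zeroʳ (not (U i) ∧ a i)

  -- This is `minors` unfolded along two leading columns, which are kept apart from `c` so that they
  -- can be exchanged.
  double-expansion : (a b : Fin r → Bool) → Bool
  double-expansion a b = Σ₂ r λ i → (not (U i) ∧ a i) ∧
                         Σ₂ r λ i′ → (not ((U ∪[ i ]) i′) ∧ b i′) ∧ minors (U ∪[ i ] ∪[ i′ ]) c

  private
    distribute : ∀ a b → double-expansion a b ≡ Σ₂ r (λ i → Σ₂ r (term a b i))
    distribute a b = Σ₂-cong r λ i → sym (Σ₂-∧ˡ r (not (U i) ∧ a i) _)

  -- Taking row i from one column and row i′ from the other leaves the same set of used rows in
  -- either order, so the terms match after the two sums are exchanged.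
  double-expansion-swap : double-expansion a b ≡ double-expansion b a
  double-expansion-swap = begin
    double-expansion a b                    ≡⟨ distribute a b ⟩
    Σ₂ r (λ i → Σ₂ r (term a b i))          ≡⟨ Σ₂-cong r (λ i → Σ₂-cong r (term-swap a b i)) ⟩
    Σ₂ r (λ i → Σ₂ r (λ i′ → term b a i′ i)) ≡⟨ Σ₂-comm r r (λ i i′ → term b a i′ i) ⟩
    Σ₂ r (λ i′ → Σ₂ r (term b a i′))        ≡⟨ distribute b a ⟨
    double-expansion b a                    ∎
    where open ≡-Reasoning

  double-expansion-diagonal : double-expansion a a ≡ false
  double-expansion-diagonal = trans (distribute a a) (Σ₂-symmetric r (term a a) (term-swap a a) term-diagonal)

-- This is the expansion with a copy of column `j` put in front of `c`. Exchanging the two leading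
-- columns moves the copy inward until it stands next to its original, where the terms cancel in
-- pairs.
repeated-column : (U : Fin r → Bool) (c : Fin m → Fin r → Bool) (j : Fin m) →
                  Σ₂ r (λ i → (not (U i) ∧ c j i) ∧ minors (U ∪[ i ]) c) ≡ false
repeated-column U c zero = double-expansion-diagonal U (c ∘ suc) (c zero) (c zero)
repeated-column {r} U c (suc j) =
  trans (double-expansion-swap U (c ∘ suc) (c (suc j)) (c zero))
        (Σ₂-zero r λ i → trans (cong ((not (U i) ∧ c zero i) ∧_) (repeated-column (U ∪[ i ]) (c ∘ suc) j))
                               (∧-zeroʳ _))

-- If a dependence has first coefficient false, some smaller minor is nonzero and induction applies.
-- Otherwise the first column is a sum of later ones, and by linearity the expansion becomes a sum
-- of expansions with a repeated column, which is zero.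
minors⇒independent : (U : Fin r → Bool) (c : Fin m → Fin r → Bool) → minors U c ≡ true →
                     TrivialKernel (λ i j → c j i)
minors⇒independent {m = zero}      U c nz v ker ()
minors⇒independent {r} {m = suc m} U c nz v ker with v zero in v₀
... | false = λ { zero → v₀ ; (suc j) → minors⇒independent (U ∪[ i ]) (c ∘ suc)
                    (∧-trueʳ {not (U i) ∧ c zero i} (proj₂ found)) (v ∘ suc) ker j }
  where
  found = Σ₂-true r nz
  i = proj₁ found
... | true = contradiction nz (false≢true (begin
  Σ₂ r (λ i → (not (U i) ∧ c zero i) ∧ D i)
    ≡⟨ Σ₂-cong r (λ i → cong (λ x → (not (U i) ∧ x) ∧ D i) (xor-false⇒≡ (c zero i) (ker i))) ⟩
  Σ₂ r (λ i → (not (U i) ∧ (v ∘ suc) · (λ j → c (suc j) i)) ∧ D i)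
    ≡⟨ Σ₂-cong r (λ i → ∧-swapʳ (not (U i)) _ (D i)) ⟩
  (λ i → not (U i) ∧ D i) · (λ i → (v ∘ suc) · (λ j → c (suc j) i))
    ≡⟨ ·-exchange (λ i → not (U i) ∧ D i) (v ∘ suc) (λ i j → c (suc j) i) ⟩
  (v ∘ suc) · (λ j → (λ i → not (U i) ∧ D i) · c (suc j))
    ≡⟨ ·-zeroʳ (v ∘ suc) (λ j → trans (Σ₂-cong r λ i → sym (∧-swapʳ (not (U i)) (c (suc j) i) (D i)))
                                      (repeated-column U (c ∘ suc) j)) ⟩
  false ∎))
  where
  open ≡-Reasoning
  D : Fin r → Bool
  D i = minors (U ∪[ i ]) (c ∘ suc)
  ∧-swapʳ : ∀ x y z → (x ∧ y) ∧ z ≡ (x ∧ z) ∧ y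
  ∧-swapʳ = solve 3 (λ x y z → (x :* y) :* z := (x :* z) :* y) refl
    where open xor-∧-Solver

-- The set `U` consists of the rows of index less than `s`. In the leading column these are used up
-- and rows of index greater than `s` carry false, so only row `s` survives, and it joins `U`.
minors-unitriangular :
  ∀ s (U : Fin r → Bool) (c : Fin m → Fin r → Bool) → s + m ≡ r →
  (∀ i → toℕ i < s → U i ≡ true) → (∀ i → s ≤ toℕ i → U i ≡ false) →
  (∀ j i → toℕ i ≡ s + toℕ j → c j i ≡ true) → (∀ j i → s + toℕ j < toℕ i → c j i ≡ false) →
  minors U c ≡ true
minors-unitriangular     {m = zero}  s U c _    U⁺ U⁻ c⁺ c⁻ = refl
minors-unitriangular {r} {m = suc m} s U c refl U⁺ U⁻ c⁺ c⁻ = begin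
  minors U c
    ≡⟨ Σ₂-single r i₀ off ⟩
  (not (U i₀) ∧ c zero i₀) ∧ minors (U ∪[ i₀ ]) (c ∘ suc)
    ≡⟨ cong₂ (λ x y → (not x ∧ y) ∧ minors (U ∪[ i₀ ]) (c ∘ suc))
             (U⁻ i₀ (ℕ.≤-reflexive (sym i₀≡s))) (c⁺ zero i₀ (trans i₀≡s (sym (ℕ.+-identityʳ s)))) ⟩
  minors (U ∪[ i₀ ]) (c ∘ suc)
    ≡⟨ minors-unitriangular (suc s) (U ∪[ i₀ ]) (c ∘ suc) (sym (ℕ.+-suc s m)) U⁺′ U⁻′
         (λ j i eq → c⁺ (suc j) i (trans eq (sym (ℕ.+-suc s (toℕ j)))))
         (λ j i lt → c⁻ (suc j) i (subst (_< toℕ i) (sym (ℕ.+-suc s (toℕ j))) lt)) ⟩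
  true ∎
  where
  open ≡-Reasoning
  s<r : s < s + suc m
  s<r = subst (s <_) (sym (ℕ.+-suc s m)) (s≤s (ℕ.m≤m+n s m))
  i₀ : Fin (s + suc m)
  i₀ = fromℕ< s<r
  i₀≡s : toℕ i₀ ≡ s
  i₀≡s = toℕ-fromℕ< s<r
  off : ∀ i → i ≢ i₀ → (not (U i) ∧ c zero i) ∧ minors (U ∪[ i ]) (c ∘ suc) ≡ false
  off i i≢ with ℕ.<-cmp (toℕ i) s
  ... | tri< i<s _ _ = cong (λ x → (not x ∧ c zero i) ∧ minors (U ∪[ i ]) (c ∘ suc)) (U⁺ i i<s)
  ... | tri≈ _ i≡s _ = contradiction (toℕ-injective (trans i≡s (sym i₀≡s))) i≢
  ... | tri> _ _ s<i = cong (_∧ minors (U ∪[ i ]) (c ∘ suc))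
    (trans (cong (not (U i) ∧_) (c⁻ zero i (subst (_< toℕ i) (sym (ℕ.+-identityʳ s)) s<i))) (∧-zeroʳ (not (U i))))
  U⁺′ : ∀ i → toℕ i < suc s → (U ∪[ i₀ ]) i ≡ true
  U⁺′ i i<1+s with i ≟ i₀
  ... | yes _ = refl
  ... | no i≢ = U⁺ i (ℕ.≤∧≢⇒< (s≤s⁻¹ i<1+s) λ i≡s → i≢ (toℕ-injective (trans i≡s (sym i₀≡s))))
  U⁻′ : ∀ i → suc s ≤ toℕ i → (U ∪[ i₀ ]) i ≡ false
  U⁻′ i s<i rewrite dec-false (i ≟ i₀) (λ { refl → ℕ.<-irrefl (sym i₀≡s) s<i }) = U⁻ i (ℕ.≤-trans (ℕ.n≤1+n s) s<i)

-- Polynomial functions on GF(2)^k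

BoolFun : ℕ → Set
BoolFun k = Vec Bool k → Bool

-- The coefficient of the first variable: f(x, t) = f(false, t) + x ∂f(t).
∂ : BoolFun (suc k) → BoolFun k
∂ f t = f (false ∷ t) xor f (true ∷ t)

-- Degree as a multilinear polynomial; only the zero function has degree less than 0.
Degree< : ℕ → BoolFun k → Set
Degree<             zero    f = ∀ t → f t ≡ false
Degree< {k = zero}  (suc d) f = ⊤
Degree< {k = suc k} (suc d) f = Degree< (suc d) (λ t → f (false ∷ t)) × Degree< d (∂ f)

Degree≤ : ℕ → BoolFun k → Set
Degree≤ d = Degree< (suc d)

Degree<-cong : ∀ d {f g : BoolFun k} → (∀ t → f t ≡ g t) → Degree< d f → Degree< d g
Degree<-cong             zero    eq h = λ t → trans (sym (eq t)) (h t)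
Degree<-cong {k = zero}  (suc d) eq h = tt
Degree<-cong {k = suc k} (suc d) eq (h , h′) =
  Degree<-cong (suc d) (λ t → eq (false ∷ t)) h ,
  Degree<-cong d (λ t → cong₂ _xor_ (eq (false ∷ t)) (eq (true ∷ t))) h′

Degree<-zero : ∀ d {f : BoolFun k} → (∀ t → f t ≡ false) → Degree< d f
Degree<-zero             zero    eq = eq
Degree<-zero {k = zero}  (suc d) eq = tt
Degree<-zero {k = suc k} (suc d) eq =
  Degree<-zero (suc d) (λ t → eq (false ∷ t)) ,
  Degree<-zero d (λ t → cong₂ _xor_ (eq (false ∷ t)) (eq (true ∷ t)))

Degree<-mono : ∀ {d e} {f : BoolFun k} → d ≤ e → Degree< d f → Degree< e f
Degree<-mono             {e = e}   z≤n     h        = Degree<-zero e h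
Degree<-mono {k = zero}            (s≤s _) h        = tt
Degree<-mono {k = suc k}           (s≤s le) (h , h′) = Degree<-mono (s≤s le) h , Degree<-mono le h′

Degree<-xor : ∀ d {f g : BoolFun k} → Degree< d f → Degree< d g → Degree< d (λ t → f t xor g t)
Degree<-xor             zero    h₁ h₂ = λ t → cong₂ _xor_ (h₁ t) (h₂ t)
Degree<-xor {k = zero}  (suc d) h₁ h₂ = tt
Degree<-xor {k = suc k} (suc d) {f} {g} (h₁ , h₁′) (h₂ , h₂′) =
  Degree<-xor (suc d) h₁ h₂ ,
  Degree<-cong d (λ t → xor-interchange (f (false ∷ t)) (f (true ∷ t)) (g (false ∷ t)) (g (true ∷ t)))
               (Degree<-xor d h₁′ h₂′)

Degree<-Σ₂ : ∀ d n {f : Fin n → BoolFun k} → (∀ i → Degree< d (f i)) → Degree< d (λ t → Σ₂ n (λ i → f i t))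
Degree<-Σ₂ d zero    h = Degree<-zero d λ _ → refl
Degree<-Σ₂ d (suc n) h = Degree<-xor d (h zero) (Degree<-Σ₂ d n (h ∘ suc))

Degree<-if : ∀ d b {f g : BoolFun k} → Degree< d f → Degree< d g → Degree< d (λ t → if b then f t else g t)
Degree<-if d true  hf hg = hf
Degree<-if d false hf hg = hg

Degree≤-const : ∀ d b → Degree≤ {k} d (λ _ → b)
Degree≤-const {k = zero}  d b = tt
Degree≤-const {k = suc k} d b = Degree≤-const d b , Degree<-zero d λ _ → xor-same b

Degree≤-lookup : (i : Fin k) → Degree≤ 1 (λ t → lookup t i)
Degree≤-lookup zero    = Degree<-zero 2 (λ _ → refl) , Degree≤-const 0 true
Degree≤-lookup (suc i) = Degree≤-lookup i , Degree<-zero 1 λ t → xor-same (lookup t i)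

-- The Leibniz rule; the product of both derivatives enters because x² = x.
∂-product : ∀ f₀ f₁ g₀ g₁ → (((f₀ xor f₁) ∧ g₀) xor ((g₀ xor g₁) ∧ f₀)) xor ((f₀ xor f₁) ∧ (g₀ xor g₁))
                            ≡ (f₀ ∧ g₀) xor (f₁ ∧ g₁)
∂-product = solve 4 (λ f₀ f₁ g₀ g₁ → (((f₀ :+ f₁) :* g₀) :+ ((g₀ :+ g₁) :* f₀)) :+ ((f₀ :+ f₁) :* (g₀ :+ g₁))
                                     := (f₀ :* g₀) :+ (f₁ :* g₁)) refl
  where open xor-∧-Solver

-- A strict bound on one factor and a weak bound on the other add up without subtraction. In the
-- term with `∂ g` the strict bound falls on that factor, so the roles are exchanged there.
Degree<-∧ : ∀ d e {f g : BoolFun k} → Degree< d f → Degree≤ e g → Degree< (d + e) (λ t → f t ∧ g t)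
Degree<-∧             zero    e {g = g} hf hg = Degree<-zero e λ t → cong (_∧ g t) (hf t)
Degree<-∧ {k = zero}  (suc d) e hf hg = tt
Degree<-∧ {k = suc k} (suc d) e {f} {g} (hf , hf′) (hg , hg′) =
  Degree<-∧ (suc d) e hf hg ,
  Degree<-cong (d + e)
    (λ t → ∂-product (f (false ∷ t)) (f (true ∷ t)) (g (false ∷ t)) (g (true ∷ t)))
    (Degree<-xor (d + e)
      (Degree<-xor (d + e) (Degree<-∧ d e hf′ hg)
        (subst (λ s → Degree< s λ t → ∂ g t ∧ f (false ∷ t)) (ℕ.+-comm e d) (Degree<-∧ e d hg′ hf)))
      (Degree<-∧ d e hf′ (Degree<-mono (ℕ.n≤1+n e) hg′)))

weight : Vec Bool k → ℕ
weight []      = 0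
weight (b ∷ t) = bit b + weight t

-- If f(false, t) is true, the first coordinate is set to false. Otherwise `∂ f` is nonzero at t; it
-- has smaller degree, and the weight saved on it pays for setting the first coordinate to true if
-- necessary.
sparse-nonzero : ∀ d {f : BoolFun k} → Degree< d f → ∀ t → f t ≡ true → ∃ λ t′ → f t′ ≡ true × weight t′ < d
sparse-nonzero zero h t ft = contradiction ft (false≢true (h t))
sparse-nonzero (suc d) h [] ft = [] , ft , s≤s z≤n
sparse-nonzero (suc d) {f} (h , h′) (b ∷ t) ft with f (false ∷ t) in f₀t
... | true with sparse-nonzero (suc d) h t f₀t
...   | t′ , ft′ , w = false ∷ t′ , ft′ , w
sparse-nonzero (suc d) {f} (h , h′) (false ∷ t) ft | false = contradiction ft (false≢true f₀t)
sparse-nonzero (suc d) {f} (h , h′) (true ∷ t)  ft | false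
  with sparse-nonzero d h′ t (cong₂ _xor_ f₀t ft)
... | t′ , ft′ , w with f (false ∷ t′) in f₀t′
...   | true  = false ∷ t′ , f₀t′ , ℕ.m<n⇒m<1+n w
...   | false = true ∷ t′ , ft′ , s≤s w

minors-degree : (U : Fin r → Bool) (c : Vec Bool k → Fin m → Fin r → Bool) →
                (∀ j i → Degree≤ 1 (λ t → c t j i)) → Degree≤ m (λ t → minors U (c t))
minors-degree     {m = zero}  U c h = Degree≤-const 0 true
minors-degree {r} {m = suc m} U c h = Degree<-Σ₂ (suc (suc m)) r λ i →
  Degree<-∧ 2 m (Degree<-∧ 1 1 (Degree≤-const 0 (not (U i))) (h zero i))
                (minors-degree (U ∪[ i ]) (λ t → c t ∘ suc) (h ∘ suc))

all : (Fin n → Bool) → Bool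
all {zero}  f = true
all {suc n} f = f zero ∧ all (f ∘ suc)

all-intro : {f : Fin n → Bool} → (∀ i → f i ≡ true) → all f ≡ true
all-intro {zero}  h = refl
all-intro {suc n} h = cong₂ _∧_ (h zero) (all-intro (h ∘ suc))

all-elim : {f : Fin n → Bool} → all f ≡ true → ∀ i → f i ≡ true
all-elim {suc n} {f} h zero    = ∧-trueˡ h
all-elim {suc n} {f} h (suc i) = all-elim (∧-trueʳ {f zero} h) i

-- Conjunction is multiplication, so degrees add, and one polynomial can express that all factors
-- are nonzero.
all-degree : ∀ d n {f : Fin n → BoolFun k} → (∀ i → Degree≤ d (f i)) → Degree≤ (n * d) (λ t → all (λ i → f i t))
all-degree d zero    h = Degree≤-const 0 true
all-degree d (suc n) h = Degree<-∧ (suc d) (n * d) (h zero) (all-degree d n (h ∘ suc))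

-- Plotkin's bound

∑-mono : {f g : Fin n → ℕ} → (∀ i → f i ≤ g i) → ∑ f ≤ ∑ g
∑-mono {zero}  h = z≤n
∑-mono {suc n} h = ℕ.+-mono-≤ (h zero) (∑-mono (h ∘ suc))

∑-const : ∀ n c → ∑ {n} (λ _ → c) ≡ n * c
∑-const zero    c = refl
∑-const (suc n) c = cong (c +_) (∑-const n c)

∑-lower : ∀ {n c} {f : Fin n → ℕ} → (∀ i → c ≤ f i) → n * c ≤ ∑ f
∑-lower {n} {c} h = subst (_≤ _) (∑-const n c) (∑-mono h)

∑-+ : ∀ k {l} (f : Fin (k + l) → ℕ) → ∑ f ≡ ∑ (f ∘ (_↑ˡ l)) + ∑ (f ∘ (k ↑ʳ_))
∑-+ zero    f = refl
∑-+ (suc k) f = trans (cong (f zero +_) (∑-+ k (f ∘ suc))) (sym (ℕ.+-assoc (f zero) _ _))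

∑-* : ∀ k {l} (f : Fin (k * l) → ℕ) → ∑ f ≡ ∑ (λ (i : Fin k) → ∑ (λ (j : Fin l) → f (combine i j)))
∑-* zero        f = refl
∑-* (suc k) {l} f = trans (∑-+ l f) (cong (∑ (f ∘ (_↑ˡ (k * l))) +_) (∑-* k (f ∘ (l ↑ʳ_))))

∑-injection : (κ : Fin m → Fin n) → (∀ {i j} → κ i ≡ κ j → i ≡ j) → (g : Fin n → ℕ) → ∑ (g ∘ κ) ≤ ∑ g
∑-injection {zero}          κ inj g = z≤n
∑-injection {suc m} {zero}  κ inj g with () ← κ zero
∑-injection {suc m} {suc n} κ inj g = begin
  g (κ zero) + ∑ (g ∘ κ ∘ suc)
    ≡⟨ cong (g (κ zero) +_) (sum-cong-≗ λ i → cong g (sym (punchIn-punchOut (distinct i)))) ⟩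
  g (κ zero) + ∑ (removeAt g (κ zero) ∘ κ′)
    ≤⟨ ℕ.+-monoʳ-≤ (g (κ zero)) (∑-injection κ′ κ′-inj (removeAt g (κ zero))) ⟩
  g (κ zero) + ∑ (removeAt g (κ zero))
    ≡⟨ sum-remove g ⟨
  ∑ g ∎
  where
  open ℕ.≤-Reasoning
  distinct : ∀ i → κ zero ≢ κ (suc i)
  distinct i eq with () ← inj eq
  κ′ : Fin m → Fin n
  κ′ i = punchOut (distinct i)
  κ′-inj : ∀ {i j} → κ′ i ≡ κ′ j → i ≡ j
  κ′-inj {i} {j} eq with refl ← inj (punchOut-injective (distinct i) (distinct j) eq) = refl

weight≡count : (t : Vec Bool k) → weight t ≡ count (lookup t)
weight≡count []      = refl
weight≡count (b ∷ t) = cong (bit b +_) (weight≡count t)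

any : (Fin n → Bool) → Bool
any {zero}  b = false
any {suc n} b = b zero ∨ any (b ∘ suc)

any-cong : {b c : Fin n → Bool} → (∀ i → b i ≡ c i) → any b ≡ any c
any-cong {zero}  eq = refl
any-cong {suc n} eq = cong₂ _∨_ (eq zero) (any-cong (eq ∘ suc))

any-false : {b : Fin n → Bool} → any b ≡ false → ∀ i → b i ≡ false
any-false {suc n} {b} eq i with b zero in b₀
any-false {suc n} {b} eq zero    | false = b₀
any-false {suc n} {b} eq (suc i) | false = any-false eq i

bit-any : (b : Fin n → Bool) → bit (any b) ≤ count b
bit-any {zero}  b = z≤n
bit-any {suc n} b with b zero
... | true  = s≤s z≤n
... | false = bit-any (b ∘ suc)

-- The sides differ by the square of m - n. The larger number is rewritten as the smaller plus the
-- difference.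
4*m*n≤[m+n]² : ∀ m n → 2 * (m * n + n * m) ≤ (m + n) * (m + n)
4*m*n≤[m+n]² m n with ℕ.≤-total m n
... | inj₁ m≤n = subst (λ x → 2 * (m * x + x * m) ≤ (m + x) * (m + x)) (ℕ.m+[n∸m]≡n m≤n)
  (ℕ.≤-trans (ℕ.m≤m+n _ ((n ∸ m) * (n ∸ m))) (ℕ.≤-reflexive (expand m (n ∸ m))))
  where
  open +-*-Solver
  expand : ∀ m d → 2 * (m * (m + d) + (m + d) * m) + d * d ≡ (m + (m + d)) * (m + (m + d))
  expand = solve 2 (λ m d → con 2 :* (m :* (m :+ d) :+ (m :+ d) :* m) :+ d :* d
                            := (m :+ (m :+ d)) :* (m :+ (m :+ d))) refl
... | inj₂ n≤m = subst (λ x → 2 * (x * n + n * x) ≤ (x + n) * (x + n)) (ℕ.m+[n∸m]≡n n≤m)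
  (ℕ.≤-trans (ℕ.m≤m+n _ ((m ∸ n) * (m ∸ n))) (ℕ.≤-reflexive (expand n (m ∸ n))))
  where
  open +-*-Solver
  expand : ∀ n d → 2 * ((n + d) * n + n * (n + d)) + d * d ≡ ((n + d) + n) * ((n + d) + n)
  expand = solve 2 (λ n d → con 2 :* ((n :+ d) :* n :+ n :* (n :+ d)) :+ d :* d
                            := ((n :+ d) :+ n) :* ((n :+ d) :+ n)) refl

count-not : (b : Fin n → Bool) → count b + count (not ∘ b) ≡ n
count-not {zero}  b = refl
count-not {suc n} b with b zero
... | true  = cong suc (count-not (b ∘ suc))
... | false = trans (ℕ.+-suc _ _) (cong suc (count-not (b ∘ suc)))

discordant-pairs : (b : Fin n → Bool) →
                   ∑ (λ i → ∑ (λ j → bit (b i xor b j))) ≡ count b * count (not ∘ b) + count (not ∘ b) * count b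
discordant-pairs b = begin
  ∑ (λ i → ∑ (λ j → bit (b i xor b j)))
    ≡⟨ sum-cong-≗ (λ i → row (b i)) ⟩
  ∑ (λ i → bit (b i) * count (not ∘ b) + bit (not (b i)) * count b)
    ≡⟨ ∑-distrib-+ (λ i → bit (b i) * count (not ∘ b)) _ ⟩
  ∑ (λ i → bit (b i) * count (not ∘ b)) + ∑ (λ i → bit (not (b i)) * count b)
    ≡⟨ cong₂ _+_ (*-distribʳ-sum (count (not ∘ b)) (bit ∘ b)) (*-distribʳ-sum (count b) (bit ∘ not ∘ b)) ⟨
  count b * count (not ∘ b) + count (not ∘ b) * count b ∎
  where
  open ≡-Reasoning
  row : ∀ x → ∑ (λ j → bit (x xor b j)) ≡ bit x * count (not ∘ b) + bit (not x) * count b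
  row true  = sym (trans (ℕ.+-identityʳ _) (ℕ.+-identityʳ _))
  row false = sym (ℕ.+-identityʳ _)

-- A column with p ones has 2p(n - p) ≤ n²/2 discordant ordered pairs. The factor `bit (any b)` lets
-- an all-zero column cost nothing, so Plotkin's bound will count only coordinates in use.
column-bound : (b : Fin n → Bool) → 2 * ∑ (λ i → ∑ (λ j → bit (b i xor b j))) ≤ n * n * bit (any b)
column-bound {n} b with any b in eq
... | true  = begin
  2 * ∑ (λ i → ∑ (λ j → bit (b i xor b j)))                    ≡⟨ cong (2 *_) (discordant-pairs b) ⟩
  2 * (count b * count (not ∘ b) + count (not ∘ b) * count b)  ≤⟨ 4*m*n≤[m+n]² (count b) _ ⟩
  (count b + count (not ∘ b)) * (count b + count (not ∘ b))    ≡⟨ cong (λ x → x * x) (count-not b) ⟩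
  n * n                                                        ≡⟨ ℕ.*-identityʳ (n * n) ⟨
  n * n * 1                                                    ∎
  where open ℕ.≤-Reasoning
... | false = begin
  2 * ∑ (λ i → ∑ (λ j → bit (b i xor b j)))
    ≡⟨ cong (2 *_) (sum-cong-≗ λ i → sum-cong-≗ λ j → cong₂ (λ x y → bit (x xor y)) (none i) (none j)) ⟩
  2 * ∑ {n} (λ _ → ∑ {n} (λ _ → 0))
    ≡⟨ cong (2 *_) (trans (∑-const n _) (cong (n *_) (trans (∑-const n 0) (ℕ.*-zeroʳ n)))) ⟩
  2 * (n * 0)
    ≡⟨ cong (2 *_) (ℕ.*-zeroʳ n) ⟩
  0
    ≤⟨ z≤n ⟩
  n * n * 0 ∎
  where
  open ℕ.≤-Reasoning
  none : ∀ i → b i ≡ false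
  none = any-false eq

-- The distances over ordered pairs are summed in two ways: by words they give at least m(m - 1)d,
-- by coordinates at most m²/2 for each one in use. The summand `2 * (m * d)` on the right avoids
-- writing m - 1.
plotkin : (x : Fin m → Fin n → Bool) (d : ℕ) →
          (∀ i j → i ≢ j → d ≤ count (λ t → x i t xor x j t)) →
          2 * (m * (m * d)) ≤ m * m * count (λ t → any (λ i → x i t)) + 2 * (m * d)
plotkin {m} {n} x d far = begin
  2 * (m * (m * d))
    ≤⟨ ℕ.*-monoʳ-≤ 2 (∑-lower (row {x = x} far)) ⟩
  2 * ∑ (λ i → ∑ (dist i) + d)
    ≡⟨ cong (2 *_) (trans (∑-distrib-+ (λ i → ∑ (dist i)) (λ _ → d)) (cong (∑ (λ i → ∑ (dist i)) +_) (∑-const m d))) ⟩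
  2 * (∑ (λ i → ∑ (dist i)) + m * d)
    ≡⟨ ℕ.*-distribˡ-+ 2 (∑ (λ i → ∑ (dist i))) (m * d) ⟩
  2 * ∑ (λ i → ∑ (dist i)) + 2 * (m * d)
    ≤⟨ ℕ.+-monoˡ-≤ (2 * (m * d)) total ⟩
  m * m * count (λ t → any (λ i → x i t)) + 2 * (m * d) ∎
  where
  open ℕ.≤-Reasoning
  dist : Fin m → Fin m → ℕ
  dist i j = count (λ t → x i t xor x j t)

  row : ∀ {m} {x : Fin m → Fin n → Bool} → (∀ i j → i ≢ j → d ≤ count (λ t → x i t xor x j t)) →
        ∀ i → m * d ≤ ∑ (λ j → count (λ t → x i t xor x j t)) + d
  row {suc m} {x} far i = begin
    d + m * d
      ≤⟨ ℕ.+-monoʳ-≤ d (∑-lower λ j → far i (punchIn i j) (punchInᵢ≢i i j ∘ sym)) ⟩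
    d + ∑ (removeAt f i)
      ≤⟨ ℕ.+-monoʳ-≤ d (ℕ.m≤n+m _ (f i)) ⟩
    d + (f i + ∑ (removeAt f i))
      ≡⟨ cong (d +_) (sum-remove f) ⟨
    d + ∑ f
      ≡⟨ ℕ.+-comm d _ ⟩
    ∑ f + d ∎
    where
    f : Fin (suc m) → ℕ
    f j = count (λ t → x i t xor x j t)

  total : 2 * ∑ (λ i → ∑ (dist i)) ≤ m * m * count (λ t → any (λ i → x i t))
  total = begin
    2 * ∑ (λ i → ∑ (dist i))
      ≡⟨ cong (2 *_) (trans (sum-cong-≗ λ i → ∑-comm (λ j t → bit (x i t xor x j t)))
                            (∑-comm (λ i t → ∑ (λ j → bit (x i t xor x j t))))) ⟩
    2 * ∑ (λ t → ∑ (λ i → ∑ (λ j → bit (x i t xor x j t))))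
      ≡⟨ *-distribˡ-sum 2 (λ t → ∑ (λ i → ∑ (λ j → bit (x i t xor x j t)))) ⟩
    ∑ (λ t → 2 * ∑ (λ i → ∑ (λ j → bit (x i t xor x j t))))
      ≤⟨ ∑-mono (λ t → column-bound (λ i → x i t)) ⟩
    ∑ (λ t → m * m * bit (any (λ i → x i t)))
      ≡⟨ *-distribˡ-sum (m * m) (λ t → bit (any (λ i → x i t))) ⟨
    m * m * count (λ t → any (λ i → x i t)) ∎

-- The zeros of `b ∘ κ` inject into the zeros of `b`, and there are m - count (b ∘ κ) of the former
-- and n - count b of the latter.
count-restrict : (κ : Fin m → Fin n) → (∀ {i j} → κ i ≡ κ j → i ≡ j) → (b : Fin n → Bool) →
                 count b + m ≤ n + count (b ∘ κ)
count-restrict {m} {n} κ inj b = begin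
  count b + m
    ≡⟨ cong (count b +_) (count-not (b ∘ κ)) ⟨
  count b + (count (b ∘ κ) + count (not ∘ b ∘ κ))
    ≤⟨ ℕ.+-monoʳ-≤ (count b) (ℕ.+-monoʳ-≤ (count (b ∘ κ)) (∑-injection κ inj (bit ∘ not ∘ b))) ⟩
  count b + (count (b ∘ κ) + count (not ∘ b))
    ≡⟨ rearrange (count b) (count (b ∘ κ)) (count (not ∘ b)) ⟩
  (count b + count (not ∘ b)) + count (b ∘ κ)
    ≡⟨ cong (_+ count (b ∘ κ)) (count-not b) ⟩
  n + count (b ∘ κ) ∎
  where
  open ℕ.≤-Reasoning
  rearrange : ∀ x y z → x + (y + z) ≡ (x + z) + y
  rearrange = solve 3 (λ x y z → x :+ (y :+ z) := (x :+ z) :+ y) refl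
    where open +-*-Solver

-- Arithmetic

combine-bounds : ∀ r M X μ W → let n = r + M in 1 ≤ M → M * M * M ≤ n →
                 2 * (M * (M * (r * n))) ≤ M * M * X + 2 * (M * (r * n)) →
                 X + n * n ≤ μ + W → W ≤ M * (M * r) →
                 M * (3 * (n * n)) ≤ M * μ + 5 * (n * n)
combine-bounds r M X μ W 1≤M M³≤s h₁ h₂ h₃ = begin
  M * (3 * (s * s))
    ≡⟨ split M r ⟩
  2 * (M * (r * s)) + (2 * (M * M * s) + M * (s * s))
    ≤⟨ ℕ.+-monoˡ-≤ _ cancelled ⟩
  (M * X + 2 * (r * s)) + (2 * (M * M * s) + M * (s * s))
    ≡⟨ regroup M X (r * s) (M * M * s) (s * s) ⟩
  M * (X + s * s) + (2 * (r * s) + 2 * (M * M * s))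
    ≤⟨ ℕ.+-mono-≤ (ℕ.*-monoʳ-≤ M (ℕ.≤-trans h₂ (ℕ.+-monoʳ-≤ μ h₃)))
                  (ℕ.+-mono-≤ (ℕ.*-monoʳ-≤ 2 (ℕ.*-monoˡ-≤ s r≤s)) (ℕ.*-monoʳ-≤ 2 (ℕ.*-monoˡ-≤ s M²≤s))) ⟩
  M * (μ + M * (M * r)) + (2 * (s * s) + 2 * (s * s))
    ≡⟨ regroup′ M μ r (s * s) ⟩
  M * μ + (M * M * M * r + 4 * (s * s))
    ≤⟨ ℕ.+-monoʳ-≤ (M * μ) (ℕ.+-monoˡ-≤ (4 * (s * s)) (ℕ.*-mono-≤ M³≤s r≤s)) ⟩
  M * μ + 5 * (s * s) ∎
  where
  open ℕ.≤-Reasoning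
  open +-*-Solver
  s : ℕ
  s = r + M
  r≤s : r ≤ s
  r≤s = ℕ.m≤m+n r M
  instance nonZero = >-nonZero 1≤M
  M²≤s : M * M ≤ s
  M²≤s = ℕ.≤-trans (ℕ.m≤m*n (M * M) M) M³≤s
  cancelled : 2 * (M * (r * s)) ≤ M * X + 2 * (r * s)
  cancelled = ℕ.*-cancelˡ-≤ M (begin
    M * (2 * (M * (r * s)))       ≡⟨ solve 2 (λ M R → M :* (con 2 :* (M :* R)) := con 2 :* (M :* (M :* R))) refl M (r * s) ⟩
    2 * (M * (M * (r * s)))       ≤⟨ h₁ ⟩
    M * M * X + 2 * (M * (r * s)) ≡⟨ solve 3 (λ M X R → M :* M :* X :+ con 2 :* (M :* R) := M :* (M :* X :+ con 2 :* R)) refl M X (r * s) ⟩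
    M * (M * X + 2 * (r * s))     ∎)
  split : ∀ M r → M * (3 * ((r + M) * (r + M)))
                  ≡ 2 * (M * (r * (r + M))) + (2 * (M * M * (r + M)) + M * ((r + M) * (r + M)))
  split = solve 2 (λ M r → M :* (con 3 :* ((r :+ M) :* (r :+ M)))
            := con 2 :* (M :* (r :* (r :+ M))) :+ (con 2 :* (M :* M :* (r :+ M)) :+ M :* ((r :+ M) :* (r :+ M)))) refl
  regroup : ∀ M X R S N → (M * X + 2 * R) + (2 * S + M * N) ≡ M * (X + N) + (2 * R + 2 * S)
  regroup = solve 5 (λ M X R S N → (M :* X :+ con 2 :* R) :+ (con 2 :* S :+ M :* N)
                                   := M :* (X :+ N) :+ (con 2 :* R :+ con 2 :* S)) refl
  regroup′ : ∀ M μ r N → M * (μ + M * (M * r)) + (2 * N + 2 * N) ≡ M * μ + (M * M * M * r + 4 * N)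
  regroup′ = solve 4 (λ M μ r N → M :* (μ :+ M :* (M :* r)) :+ (con 2 :* N :+ con 2 :* N)
                                  := M :* μ :+ (M :* M :* M :* r :+ con 4 :* N)) refl

cube-root : ∀ n → 1 ≤ n → ∃ λ M → 1 ≤ M × M * M * M ≤ n × n < suc M * suc M * suc M
cube-root (suc zero)    _ = 1 , s≤s z≤n , ℕ.≤-refl , s≤s (s≤s z≤n)
cube-root (suc (suc n)) _ with cube-root (suc n) (s≤s z≤n)
... | M , 1≤M , lo , hi with suc M * suc M * suc M ℕ.≤? suc (suc n)
... | yes le = suc M , s≤s z≤n , le ,
  ℕ.≤-<-trans hi (ℕ.*-mono-< (ℕ.*-mono-< (ℕ.n<1+n (suc M)) (ℕ.n<1+n (suc M))) (ℕ.n<1+n (suc M)))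
... | no ¬le = M , 1≤M , ℕ.m≤n⇒m≤1+n lo , ℕ.≰⇒> ¬le

-- From n < (M + 1)³ ≤ (2M)³ follows nE³ ≤ 8(ME)³ ≤ 1000n⁶, and a factor n cancels. Thus 10 is 2
-- times 5, and the cubes express E ≤ 10n^(5/3) in natural numbers.
cube-bound : ∀ n M E → 1 ≤ n → 1 ≤ M → n < suc M * suc M * suc M → M * E ≤ 5 * (n * n) →
             E ^ 3 ≤ 10 ^ 3 * n ^ 5
cube-bound n M E 1≤n 1≤M hi h = ℕ.*-cancelˡ-≤ n (begin
  n * E ^ 3
    ≤⟨ ℕ.*-monoˡ-≤ (E ^ 3) (ℕ.≤-trans (ℕ.<⇒≤ hi) (ℕ.*-mono-≤ (ℕ.*-mono-≤ 1+M≤2M 1+M≤2M) 1+M≤2M)) ⟩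
  2 * M * (2 * M) * (2 * M) * E ^ 3
    ≡⟨ solve 2 (λ M E → con 2 :* M :* (con 2 :* M) :* (con 2 :* M) :* E :^ 3
                        := con 8 :* ((M :* E) :* (M :* E) :* (M :* E))) refl M E ⟩
  8 * ((M * E) * (M * E) * (M * E))
    ≤⟨ ℕ.*-monoʳ-≤ 8 (ℕ.*-mono-≤ (ℕ.*-mono-≤ h h) h) ⟩
  8 * (5 * (n * n) * (5 * (n * n)) * (5 * (n * n)))
    ≡⟨ solve 1 (λ n → con 8 :* (con 5 :* (n :* n) :* (con 5 :* (n :* n)) :* (con 5 :* (n :* n)))
                      := n :* (con 1000 :* n :^ 5)) refl n ⟩
  n * (10 ^ 3 * n ^ 5) ∎)
  where
  open ℕ.≤-Reasoning
  open +-*-Solver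
  instance nonZero = >-nonZero 1≤n
  1+M≤2M : suc M ≤ 2 * M
  1+M≤2M = ℕ.+-mono-≤ 1≤M (ℕ.≤-reflexive (sym (ℕ.+-identityʳ M)))

-- Matrix multiplication

if-true : {P : Set} (p? : Dec P) {b : Bool} → (P → b ≡ true) → (if does p? then b else true) ≡ true
if-true (yes p) h = h p
if-true (no _)  h = refl

-- Writing the matrix size as `r + M` gives the minor size r = n - M without truncated subtraction.
module _ (r M : ℕ) {μ : ℕ} where

  private
    s N : ℕ
    s = r + M
    N = s * s

  module _ (f g : Fin μ → Fin (NVars s) → Bool) (Φ : Fin μ → Fin N → Bool)
           (computes : ∀ A a b → (λ t → A · Φ t) · (λ t → quad (mulLin (f t) (g t)) a b) ≡ form s A a b)
    where

    code : (Fin N → Bool) → Fin μ → Bool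
    code A t = A · Φ t

    -- If the codeword is zero, so is the form of `A`, and its coefficient at the variables (i, i)
    -- of x and (i, j) of y is the entry (i, j) of `A`.
    code-injective : TrivialKernel Φ
    code-injective A zeros e = begin
      A e
        ≡⟨ cong A (combine-remQuot {s} s e) ⟨
      A (combine i j)
        ≡⟨ trans (cong (A (combine i j) ∧_) (dec-true (i ≟ i) refl)) (∧-identityʳ _) ⟨
      A (combine i j) ∧ does (i ≟ i)
        ≡⟨ form-xy s A i i i j ⟨
      form s A (xv i i) (yv i j)
        ≡⟨ computes A (xv i i) (yv i j) ⟨
      code A · (λ t → quad (mulLin (f t) (g t)) (xv i i) (yv i j))
        ≡⟨ ·-zeroˡ _ zeros ⟩
      false ∎
      where
      open ≡-Reasoning
      i = quotient {s} s e
      j = remainder {s} s e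

    abstract
      κ : Fin N → Fin μ
      κ = proj₁ (information-set Φ code-injective)

      κ-trivial : TrivialKernel (Φ ∘ κ)
      κ-trivial = proj₂ (information-set Φ code-injective)

      basis : Fin N → Fin N → Bool
      basis u = proj₁ (solve-square (Φ ∘ κ) κ-trivial (λ u′ → does (u ≟ u′)))

      basis-dual : ∀ u u′ → code (basis u) (κ u′) ≡ does (u ≟ u′)
      basis-dual u = proj₂ (solve-square (Φ ∘ κ) κ-trivial (λ u′ → does (u ≟ u′)))

    -- The codeword of `basis u` is true at `κ u` and false at every other `κ u′`.
    κ-injective : ∀ {u u′} → κ u ≡ κ u′ → u ≡ u′
    κ-injective {u} {u′} eq with u ≟ u′
    ... | yes u≡u′ = u≡u′
    ... | no u≢u′  = contradiction
      (trans (sym (cong (code (basis u)) eq)) (trans (basis-dual u u) (dec-true (u ≟ u) refl)))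
      (false≢true (trans (basis-dual u u′) (dec-false (u ≟ u′) u≢u′)))

    span : (Fin N → Bool) → Fin N → Bool
    span τ e = τ · (λ u → basis u e)

    code-span : ∀ τ u → code (span τ) (κ u) ≡ τ u
    code-span τ u = begin
      span τ · Φ (κ u)                                      ≡⟨ ·-comm (span τ) (Φ (κ u)) ⟩
      Φ (κ u) · (λ e → τ · (λ u′ → basis u′ e))             ≡⟨ ·-exchange (Φ (κ u)) τ (λ e u′ → basis u′ e) ⟩
      τ · (λ u′ → Φ (κ u) · basis u′)                       ≡⟨ ·-cong {u = τ} (λ _ → refl) (λ u′ →
                                                                 trans (·-comm (Φ (κ u)) (basis u′)) (basis-dual u′ u)) ⟩
      τ · (λ u′ → does (u′ ≟ u))                            ≡⟨ Σ₂-δ N u τ ⟩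
      τ u                                                   ∎
      where open ≡-Reasoning

    -- The reconstruction and `A` have the same codeword on the information set, so their difference
    -- is in a trivial kernel.
    span-coordinates : ∀ A e → span (λ u → code A (κ u)) e ≡ A e
    span-coordinates A e = xor-false⇒≡ _ (κ-trivial (λ e → B e xor A e) zeros e)
      where
      B = span (λ u → code A (κ u))
      zeros : ∀ u → (λ e → B e xor A e) · Φ (κ u) ≡ false
      zeros u = trans (·-xorˡ B A (Φ (κ u)))
                      (trans (cong (_xor code A (κ u)) (code-span _ u)) (xor-same (code A (κ u))))

    ρ : Fin r → Fin s
    ρ p = p ↑ˡ M

    γ : Fin M → Fin r → Fin s
    γ i q = fromℕ< (ℕ.+-mono-< (toℕ<n q) (toℕ<n i))

    coordinates : Vec Bool (M * N) → Fin M → Fin N → Bool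
    coordinates t i u = lookup t (combine i u)

    difference : Vec Bool (M * N) → Fin M → Fin M → Fin N → Bool
    difference t i j e = span (coordinates t i) e xor span (coordinates t j) e

    block : Vec Bool (M * N) → Fin M → Fin M → Fin r → Fin r → Bool
    block t i j q p = difference t i j (combine (ρ p) (γ i q))

    -- Pairs without i < j get the neutral value `true`, so the conjunction may run over all pairs.
    separated : Fin M → Fin M → Vec Bool (M * N) → Bool
    separated i j t = if does (i <? j) then minors (λ _ → false) (block t i j) else true

    all-separated : Vec Bool (M * N) → Bool
    all-separated t = all λ i → all λ j → separated i j t

    all-separated-degree : Degree≤ (M * (M * r)) all-separated
    all-separated-degree = all-degree (M * r) M λ i → all-degree r M λ j → separated-degree i j
      where
      span-degree : ∀ i e → Degree≤ 1 (λ t → span (coordinates t i) e)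
      span-degree i e = Degree<-Σ₂ 2 N λ u →
        Degree<-∧ 2 0 (Degree≤-lookup (combine i u)) (Degree≤-const 0 (basis u e))
      separated-degree : ∀ i j → Degree≤ r (separated i j)
      separated-degree i j = Degree<-if (suc r) (does (i <? j))
        (minors-degree (λ _ → false) (λ t → block t i j) λ q p →
          Degree<-xor 2 (span-degree i (combine (ρ p) (γ i q))) (span-degree j (combine (ρ p) (γ i q))))
        (Degree≤-const r true)

    -- The i-th power of the nilpotent shift: for i < j the difference of the i-th and the j-th
    -- power is unitriangular on the rows 0, …, r − 1 and the columns i, …, i + r − 1.
    shift : Fin M → Fin N → Bool
    shift i e = does (toℕ (remainder {s} s e) ℕ.≟ toℕ (quotient {s} s e) + toℕ i)

    -- The coordinates of a matrix in the dual basis are its codeword read on the information set.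
    shift-point : Vec Bool (M * N)
    shift-point = tabulate λ c → code (shift (quotient N c)) (κ (remainder {M} N c))

    span-shift : ∀ i e → span (coordinates shift-point i) e ≡ shift i e
    span-shift i e = trans (·-cong {v = λ u → basis u e} (λ u → trans
        (lookup∘tabulate _ (combine i u))
        (cong (λ (i′ , u′) → code (shift i′) (κ u′)) (remQuot-combine i u))) (λ _ → refl))
      (span-coordinates (shift i) e)

    block-shift : ∀ i j q p → block shift-point i j q p ≡
                  does (toℕ q + toℕ i ℕ.≟ toℕ p + toℕ i) xor does (toℕ q + toℕ i ℕ.≟ toℕ p + toℕ j)
    block-shift i j q p = cong₂ _xor_ (entry i) (entry j)
      where
      entry : ∀ k → span (coordinates shift-point k) (combine (ρ p) (γ i q)) ≡
                    does (toℕ q + toℕ i ℕ.≟ toℕ p + toℕ k)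
      entry k = trans (span-shift k _) (trans
        (cong (λ (x , y) → does (toℕ y ℕ.≟ toℕ x + toℕ k)) (remQuot-combine (ρ p) (γ i q)))
        (cong₂ (λ x y → does (y ℕ.≟ x + toℕ k)) (toℕ-↑ˡ p M) (toℕ-fromℕ< (ℕ.+-mono-< (toℕ<n q) (toℕ<n i)))))

    shift-separated : all-separated shift-point ≡ true
    shift-separated = all-intro λ i → all-intro λ j → pair i j
      where
      pair : ∀ i j → separated i j shift-point ≡ true
      pair i j = if-true (i <? j) λ i<j →
        minors-unitriangular 0 (λ _ → false) (block shift-point i j) refl
          (λ _ ()) (λ _ _ → refl) (on-diagonal i<j) (below-diagonal i<j)
        where
        -- The i-th power fills the diagonal of the block. The ones of the j-th power lie strictly
        -- above it, since q + i = p + j with i < j forces p < q.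
        on-diagonal : toℕ i < toℕ j → ∀ q p → toℕ p ≡ toℕ q → block shift-point i j q p ≡ true
        on-diagonal i<j q p p≡q = trans (block-shift i j q p) (cong₂ _xor_
          (dec-true (_ ℕ.≟ _) (cong (_+ toℕ i) (sym p≡q)))
          (dec-false (_ ℕ.≟ _) (ℕ.<⇒≢ (ℕ.+-mono-≤-< (ℕ.≤-reflexive (sym p≡q)) i<j))))
        below-diagonal : toℕ i < toℕ j → ∀ q p → toℕ q < toℕ p → block shift-point i j q p ≡ false
        below-diagonal i<j q p q<p = trans (block-shift i j q p) (cong₂ _xor_
          (dec-false (_ ℕ.≟ _) (ℕ.<⇒≢ (ℕ.+-monoˡ-< (toℕ i) q<p)))
          (dec-false (_ ℕ.≟ _) (ℕ.<⇒≢ (ℕ.+-mono-< q<p i<j))))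

    abstract
      -- The shifts only certify that the polynomial is nonzero; the matrices used from here on come
      -- from a sparse point instead.
      sparse-point : ∃ λ t → all-separated t ≡ true × weight t < suc (M * (M * r))
      sparse-point = sparse-nonzero (suc (M * (M * r))) all-separated-degree shift-point shift-separated

    point : Vec Bool (M * N)
    point = proj₁ sparse-point

    word : Fin M → Fin μ → Bool
    word i = code (span (coordinates point i))

    -- By linearity the difference of two words is the codeword of the difference matrix. Its
    -- nonvanishing minor supplies the invertible submatrix for `rank-bound`.
    distance< : ∀ i j → toℕ i < toℕ j → r * s ≤ count (λ t → word i t xor word j t)
    distance< i j i<j = subst (r * s ≤_)
      (sum-cong-≗ λ t → cong bit (·-xorˡ (span (coordinates point i)) (span (coordinates point j)) (Φ t)))
      (rank-bound f g (code A) A (computes A) ρ (γ i)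
        (transpose-trivial (λ p q → block point i j q p)
          (minors⇒independent (λ _ → false) (block point i j) nonzero)))
      where
      A = difference point i j
      nonzero : minors (λ _ → false) (block point i j) ≡ true
      nonzero = trans (sym (cong (λ b → if b then minors (λ _ → false) (block point i j) else true) (dec-true (i <? j) i<j)))
                      (all-elim (all-elim (proj₁ (proj₂ sparse-point)) i) j)

    distance : ∀ i j → i ≢ j → r * s ≤ count (λ t → word i t xor word j t)
    distance i j i≢j = case <-cmp i j of λ where
      (tri< i<j _ _) → distance< i j i<j
      (tri≈ _ i≡j _) → contradiction i≡j i≢j
      (tri> _ _ j<i) → subst (r * s ≤_) (sum-cong-≗ λ t → cong bit (xor-comm (word j t) (word i t)))
                             (distance< j i j<i)

    active : ℕ
    active = count (λ u → any (λ i → coordinates point i u))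

    -- The union of the supports of the M coordinate vectors is at most the sum of their sizes,
    -- which is the weight of `point`.
    active-bound : active ≤ M * (M * r)
    active-bound = begin
      ∑ (λ u → bit (any (λ i → coordinates point i u)))
        ≤⟨ ∑-mono (λ u → bit-any (λ i → coordinates point i u)) ⟩
      ∑ (λ u → ∑ (λ i → bit (coordinates point i u)))
        ≡⟨ ∑-comm (λ u i → bit (coordinates point i u)) ⟩
      ∑ (λ i → ∑ (λ u → bit (coordinates point i u)))
        ≡⟨ ∑-* M (bit ∘ lookup point) ⟨
      count (lookup point)
        ≡⟨ weight≡count point ⟨
      weight point
        ≤⟨ s≤s⁻¹ (proj₂ (proj₂ sparse-point)) ⟩
      M * (M * r) ∎
      where open ℕ.≤-Reasoning

    gates-bound : 1 ≤ M → M * M * M ≤ s → M * (3 * N) ≤ M * μ + 5 * N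
    gates-bound 1≤M M³≤s = combine-bounds r M (count used) μ active 1≤M M³≤s
      (plotkin word (r * s) distance)
      -- On the information set a word is its coordinate vector, so `used` restricted along `κ` has
      -- `active` many true values.
      (subst (λ x → count used + N ≤ μ + x)
        (sum-cong-≗ λ u → cong bit (any-cong λ i → code-span (coordinates point i) u))
        (count-restrict κ κ-injective used))
      active-bound
      where
      used : Fin μ → Bool
      used t = any (λ i → word i t)

matmul-bound : ∀ r M (Γ : Circuit (NVars (r + M)) k) → ComputesMatMul (r + M) Γ → 1 ≤ M → M * M * M ≤ r + M →
               let n = r + M in M * (3 * (n * n)) ≤ M * numProducts Γ + 5 * (n * n)
matmul-bound r M Γ (out , correct) = gates-bound r M left right Φ computes
  where
  open Decomposition (decompose Γ)
  open ≡-Reasoning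
  s : ℕ
  s = r + M
  gate : Fin (s * s) → Fin _
  gate e = out (quotient {s} s e) (remainder {s} s e)
  Φ : Fin (numProducts Γ) → Fin (s * s) → Bool
  Φ t e = coef (gate e) t
  computes : ∀ A a b → (λ t → A · Φ t) · (λ t → quad (mulLin (left t) (right t)) a b) ≡ form s A a b
  computes A a b = begin
    (λ t → A · Φ t) · h
      ≡⟨ ·-comm (λ t → A · Φ t) h ⟩
    h · (λ t → A · Φ t)
      ≡⟨ ·-exchange h A Φ ⟩
    A · (λ e → h · coef (gate e))
      ≡⟨ ·-cong {u = A} (λ _ → refl) (λ e → trans (·-comm h (coef (gate e)))
           (trans (sym (quad-coef (gate e) a b)) (proj₂ (correct _ _) a b))) ⟩
    form s A a b ∎
    where
    h : Fin (numProducts Γ) → Bool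
    h t = quad (mulLin (left t) (right t)) a b

theorem2 : Σ ℕ λ C → (n : ℕ) → 1 ≤ n → (k : ℕ) → (Γ : Circuit (NVars n) k) →
    Quadratic Γ → ComputesMatMul n Γ →
    (3 * (n * n) ∸ numProducts Γ) ^ 3 ≤ C ^ 3 * n ^ 5
theorem2 = 10 , λ n 1≤n k Γ _ correct →
  let M , 1≤M , M³≤n , n<[1+M]³ = cube-root n 1≤n
      M≤n = ℕ.≤-trans (m≤m³ M 1≤M) M³≤n
  in cube-bound n M _ 1≤n 1≤M n<[1+M]³
       (deficit-bound n M Γ correct 1≤M M³≤n (n ∸ M) (ℕ.m∸n+n≡m M≤n))
  where
  m≤m³ : ∀ m → 1 ≤ m → m ≤ m * m * m
  m≤m³ (suc m) _ = ℕ.m≤n*m (suc m) (suc m * suc m)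
  -- The equation `r + M ≡ n` is a separate argument so that matching it gives the circuit the size
  -- `r + M`.
  deficit-bound : ∀ n M {k} (Γ : Circuit (NVars n) k) → ComputesMatMul n Γ → 1 ≤ M → M * M * M ≤ n →
                 ∀ r → r + M ≡ n → M * (3 * (n * n) ∸ numProducts Γ) ≤ 5 * (n * n)
  deficit-bound _ M Γ correct 1≤M M³≤n r refl =
    ℕ.≤-trans (ℕ.≤-reflexive (ℕ.*-distribˡ-∸ M _ (numProducts Γ)))
              (ℕ.m≤n+o⇒m∸n≤o _ (M * numProducts Γ) (matmul-bound r M Γ correct 1≤M M³≤n))
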